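{- Let $A \subset \mathbb{Z}^d$ be a finite set such that $A - A$ generates $\mathbb{Z}^d$ additively and its convex hull $\Delta_A$ is a $d$-dimensional simplex. Then there exists a polynomial $p \in \mathbb{Q}[x]$ such that $|hA| = p(h)$ for all integers $h \geq 0$ with $h \geq \mathrm{vol}(\Delta_A)\cdot (d+1)! - 1 - 3d$.
   Context: For integer $h \geq 0$, $hA = \{a_1 + \cdots + a_h : a_i \in A\}$, with $0A = \{0\}$. $\mathrm{vol}(\Delta_A)$ denotes the $d$-dimensional volume of the convex hull of $A$. -}

module Defs where

open import Data.Integer.Base as ℤ using (ℤ; +_; 0ℤ; 1ℤ)
import Data.Integer.Properties as ℤ
open import Data.List.Base as List
  using (List; []; _∷_; length; cartesianProductWith; deduplicate)
import Data.List.Membership.Propositional as List using (_∈_)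
import Data.List.Relation.Unary.Any as List using (Any)
import Data.List.Relation.Unary.All as List using (All)
open import Data.List.Relation.Unary.Unique.Propositional using (Unique)
open import Data.Nat.Base as ℕ using (ℕ; zero; suc; NonZero)
import Data.Nat.Properties as ℕ
open import Data.Product.Base using (Σ; _×_)
open import Data.Rational.Base
  using (ℚ; _/_; 0ℚ; 1ℚ; _+_; _*_; _-_; _≤_; _<_)
open import Data.Vec.Base as Vec using (Vec; []; _∷_; zipWith; replicate; foldr′)
import Data.Vec.Properties as Vec
open import Data.Vec.Relation.Binary.Pointwise.Inductive using (Pointwise)
open import Data.Vec.Relation.Unary.All using (All)
open import Function.Bundles using (_⇔_)
open import Level using (0ℓ)
open import Relation.Binary.Definitions using (DecidableEquality)
open import Relation.Binary.PropositionalEquality using (_≡_)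
open import Relation.Unary using (Pred; _∈_; _⊆_)

fromℤ : ℤ → ℚ
fromℤ i = i / 1

fromℕ : ℕ → ℚ
fromℕ n = fromℤ (+ n)

-- Coefficient lists, constant term first; trailing zeros are allowed.

ℚ[x] : Set
ℚ[x] = List ℚ

eval : ℚ[x] → ℚ → ℚ
eval []       x = 0ℚ
eval (c ∷ cs) x = c + x * eval cs x

Lattice : ℕ → Set
Lattice d = Vec ℤ d

-- A finite subset of ℤ^d is given by a list enumerating its elements. The
-- order and multiplicity of the entries are irrelevant: only the set of
-- entries matters in all the notions below.

FiniteSet : ℕ → Set
FiniteSet d = List (Lattice d)

module _ {d : ℕ} where

  _≟_ : DecidableEquality (Lattice d)
  _≟_ = Vec.≡-dec ℤ._≟_

  ∣_∣ : FiniteSet d → ℕ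
  ∣ A ∣ = length (deduplicate _≟_ A)

  origin : Lattice d
  origin = replicate d 0ℤ

  _⊕_ _⊖_ : FiniteSet d → FiniteSet d → FiniteSet d
  _⊕_ = cartesianProductWith (zipWith ℤ._+_)
  _⊖_ = cartesianProductWith (zipWith ℤ._-_)

  _·_ : ℕ → FiniteSet d → FiniteSet d
  zero  · A = origin ∷ []
  suc h · A = A ⊕ (h · A)

  data ⟨_⟩ (G : FiniteSet d) : Pred (Lattice d) 0ℓ where
    gen  : ∀ {x} → x List.∈ G → x ∈ ⟨ G ⟩
    zero : origin ∈ ⟨ G ⟩
    add  : ∀ {x y} → x ∈ ⟨ G ⟩ → y ∈ ⟨ G ⟩ → zipWith ℤ._+_ x y ∈ ⟨ G ⟩
    neg  : ∀ {x} → x ∈ ⟨ G ⟩ → Vec.map ℤ.-_ x ∈ ⟨ G ⟩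

  Generates : FiniteSet d → Set
  Generates G = ∀ x → x ∈ ⟨ G ⟩

-- Convex geometry takes place in ℚ^d. The rational convex hull of finitely
-- many rational points is the set of rational points of their real convex
-- hull and is dense in it.

Point : ℕ → Set
Point d = Vec ℚ d

sum : ∀ {n} → Vec ℚ n → ℚ
sum = foldr′ _+_ 0ℚ

module _ {d : ℕ} where

  combination : ∀ {n} → Vec ℚ n → Vec (Point d) n → Point d
  combination ws ps =
    foldr′ (zipWith _+_) (replicate d 0ℚ)
      (zipWith (λ w p → Vec.map (w *_) p) ws ps)

  conv : ∀ {n} → Vec (Point d) n → Pred (Point d) 0ℓ
  conv {n} ps x = Σ (Vec ℚ n) λ ws →
    All (0ℚ ≤_) ws × sum ws ≡ 1ℚ × x ≡ combination ws ps

  AffinelyIndependent : ∀ {n} → Vec (Point d) n → Set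
  AffinelyIndependent {n} ps = (ws : Vec ℚ n) →
    sum ws ≡ 0ℚ → combination ws ps ≡ replicate d 0ℚ → All (_≡ 0ℚ) ws

  IsSimplex : ℕ → Pred (Point d) 0ℓ → Set
  IsSimplex k S = Σ (Vec (Point d) (suc k)) λ vs →
    AffinelyIndependent vs × (∀ x → (x ∈ S) ⇔ (x ∈ conv vs))

  Δ : FiniteSet d → Pred (Point d) 0ℓ
  Δ A = conv (Vec.fromList (List.map (Vec.map fromℤ) A))

  -- The half-open cube of side 1/n with lowest corner k/n. For fixed n these
  -- cubes partition space as k ranges over ℤ^d.

  Cube : (n : ℕ) .{{_ : NonZero n}} → Lattice d → Pred (Point d) 0ℓ
  Cube n k x = Pointwise (λ kᵢ xᵢ → kᵢ / n ≤ xᵢ × xᵢ < (kᵢ ℤ.+ 1ℤ) / n) k x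

  totalVolume : (n : ℕ) .{{_ : NonZero n}} → List (Lattice d) → ℚ
  totalVolume n ks = _/_ (+ length ks) (n ℕ.^ d) {{ℕ.m^n≢0 n d}}

  -- d-dimensional volume as Jordan content: S has volume V if finite unions of
  -- grid cubes contained in S, and finite unions of grid cubes covering S, have
  -- total volumes arbitrarily close to V. The inner cubes are required to be
  -- distinct, hence disjoint. For a polytope with rational vertices,
  -- containing or being covered by such cubes in ℝ^d is the same as doing so at
  -- all rational points, so V is the volume of the real polytope.

  HasVolume : Pred (Point d) 0ℓ → ℚ → Set
  HasVolume S V = (ε : ℚ) → 0ℚ < ε → Inner ε × Outer ε
    where
    Inner Outer : ℚ → Set
    Inner ε = Σ ℕ λ n → Σ (NonZero n) λ n≢0 → Σ (List (Lattice d)) λ ks →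
      Unique ks × List.All (λ k → Cube n {{n≢0}} k ⊆ S) ks ×
      V - ε < totalVolume n {{n≢0}} ks
    Outer ε = Σ ℕ λ n → Σ (NonZero n) λ n≢0 → Σ (List (Lattice d)) λ ks →
      (∀ {x} → x ∈ S → List.Any (λ k → x ∈ Cube n {{n≢0}} k) ks) ×
      totalVolume n {{n≢0}} ks < V + ε

{-# OPTIONS --safe #-}

-- Every vertex of Δ A belongs to A. In barycentric coordinates, multiplied by a common
-- denominator D, the set A becomes a set B of vectors in ℕ^(d+1) with coordinate sum D
-- that contains the vectors D eᵢ, and |hA| = |hB|.
--
-- Call a sequence of elements of B good if no nonempty block of consecutive terms has a sum
-- divisible by D. The l + 1 suffix sums of a good sequence of length l are incongruent modulo D,
-- and translating them by sums of the D eᵢ gives |hA| ≥ (l + 1) h^d / d! - O(h^(d-1)). A covering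
-- of Δ A by grid cubes bounds |hA| from above, so l + 1 ≤ d! vol. Hence, for m + 1 = ⌊d! vol⌋,
-- replacing blocks with divisible sum by sums of the D eᵢ shows that every element of hB is a
-- sum of at most m elements of B and of some D eᵢ.
--
-- The (d+1)-st difference of h ↦ |hB| is a sum over x in (h + d + 1)B of the alternating sums
-- over I ⊆ {0, …, d} of the indicators of x - Σ_{i ∈ I} D eᵢ lying in (h + d + 1 - |I|)B. Above the
-- threshold there is an index i such that D eᵢ can be split off from every element of these
-- sumsets that is congruent to x and has the same i-th coordinate; toggling i in I then cancels
-- all terms. A function whose (d+1)-st difference vanishes beyond some point is a polynomial there.

module Submission where

-- The vertices of `Δ A` are integral, so `d! vol` is the order of the quotient of ℤ^d by the
-- lattice spanned by the edges of the simplex, and a good sequence is one without a consecutive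
-- zero-sum block in this finite group. Neither the group nor a determinant is ever formed:
-- congruence modulo `D` of lifted vectors replaces equality of classes, and counting points,
-- asymptotically h^d / d! for each class, replaces the order by the volume. The threshold arises as
-- follows. The point `x` has total (h + d + 1) D. A coordinate above m (D - 1) supplies the index i
-- at once, since m elements of `B` other than D eᵢ cannot reach it. Otherwise a failure to split
-- off D eᵢ leaves a vector u with total at most m D, with uᵢ = xᵢ and u congruent to x. For m > 0
-- each of the other d differences xⱼ - uⱼ is a multiple of D below m D, hence at most (m - 1) D,
-- and so h + d + 1 ≤ m + d (m - 1). This is impossible once h ≥ (d + 1) m - 2d = (d + 1)(m + 1) - 1
-- - 3d, and m + 1 ≤ d! vol gives the stated bound.

open import Defs
open import Data.Bool.Base using (if_then_else_)
open import Data.Empty using (⊥; ⊥-elim)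
open import Data.Fin.Base using (Fin; zero; suc)
import Data.Fin.Properties as Fin
open import Data.Integer.Base as ℤ using (ℤ; +_; 0ℤ; 1ℤ; +≤+)
import Data.Integer.DivMod as ℤ
open import Data.Integer.Divisibility.Signed as ∣ using (_∣_; divides; _∣?_)
import Data.Integer.Properties as ℤ
import Data.Integer.Tactic.RingSolver as ℤ-Solver
open import Data.List.Base as List using (List; []; _∷_; _++_; length; filter; deduplicate)
import Data.List.Membership.DecPropositional as DecMembership
open import Data.List.Membership.Propositional using (_∈_)
import Data.List.Membership.Propositional.Properties as ∈
import Data.List.Properties as List
open import Data.List.Relation.Binary.Subset.Propositional using (_⊆_)
open import Data.List.Relation.Unary.All as All using (All; []; _∷_)
import Data.List.Relation.Unary.All.Properties as All
open import Data.List.Relation.Unary.AllPairs using ([]; _∷_)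
open import Data.List.Relation.Unary.Any as Any using (here; there)
import Data.List.Relation.Unary.Unique.DecPropositional.Properties as Dedup
open import Data.List.Relation.Unary.Unique.Propositional using (Unique)
import Data.List.Relation.Unary.Unique.Propositional.Properties as Unique
open import Data.Nat.Base as ℕ using (ℕ; zero; suc; z≤n; s≤s; _!)
import Data.Nat.Properties as ℕ
import Data.Nat.Tactic.RingSolver as ℕ-Solver
open import Data.Product.Base using (Σ; ∃; ∃₂; _×_; _,_; proj₁; proj₂)
open import Data.Rational.Base as ℚ
  using (ℚ; _/_; 0ℚ; 1ℚ; _+_; _*_; _-_; -_; _≤_; _<_; ↥_; ↧ₙ_; toℚᵘ)
import Data.Rational.Properties as ℚ
open import Data.Rational.Unnormalised.Base as ℚᵘ using (mkℚᵘ; *≡*)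
import Data.Rational.Unnormalised.Properties as ℚᵘ
open import Data.Sum.Base using (_⊎_; inj₁; inj₂; [_,_]′)
open import Data.Vec.Base as Vec using (Vec; []; _∷_; zipWith; lookup; replicate; _[_]≔_)
import Data.Vec.Properties as Vec
open import Data.Vec.Relation.Binary.Pointwise.Inductive using (Pointwise; []; _∷_)
open import Data.Vec.Relation.Unary.All as VecAll using ([]; _∷_)
import Data.Vec.Relation.Unary.All.Properties as VecAll
open import Function.Base using (_∘_; id)
open import Function.Bundles using (_⇔_; Equivalence)
open import Level using (0ℓ)
open import Relation.Binary.PropositionalEquality
open import Relation.Nullary using (Dec; yes; no; does; ¬_)
open import Relation.Nullary.Decidable.Core using (dec⇒maybe)
import Tactic.RingSolver as ℚ-Solver
open import Tactic.RingSolver.Core.AlmostCommutativeRing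
  using (AlmostCommutativeRing; fromCommutativeRing)

-- Sums of indicators

-- Pigeonhole principle for a relation instead of a function. The partner of the first `x` is cut
-- out of `ys`; by `inj` no other entry of `xs` can be related to it, so the remaining partners
-- survive the cut.
length-≤ : ∀ {X Y : Set} (R : X → Y → Set) → (∀ {x x′ y} → R x y → R x′ y → x ≡ x′) →
  ∀ {xs ys} → Unique xs → (∀ {x} → x ∈ xs → ∃ λ y → y ∈ ys × R x y) →
  length xs ℕ.≤ length ys
length-≤ R inj {[]} _ _ = z≤n
length-≤ R inj {x ∷ xs} (x∉xs ∷ uniq) f with f (here refl)
... | y , y∈ys , Rxy with ∈.∈-∃++ y∈ys
... | as , bs , refl = begin
  suc (length xs)                 ≤⟨ s≤s (length-≤ R inj uniq g) ⟩
  suc (length (as ++ bs))         ≡⟨ cong suc (List.length-++ as) ⟩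
  suc (length as ℕ.+ length bs)   ≡⟨ ℕ.+-suc (length as) (length bs) ⟨
  length as ℕ.+ suc (length bs)   ≡⟨ List.length-++ as ⟨
  length (as ++ y ∷ bs)           ∎
  where
  open ℕ.≤-Reasoning
  g : ∀ {x′} → x′ ∈ xs → ∃ λ y′ → y′ ∈ as ++ bs × R x′ y′
  g {x′} x′∈ with f (there x′∈)
  ... | y′ , y′∈ , Rx′y′ with ∈.∈-++⁻ as y′∈
  ... | inj₁ p           = y′ , ∈.∈-++⁺ˡ p , Rx′y′
  ... | inj₂ (there p)   = y′ , ∈.∈-++⁺ʳ as p , Rx′y′
  ... | inj₂ (here refl) = ⊥-elim (All.lookup x∉xs x′∈ (inj Rxy Rx′y′))

length-⊆ : ∀ {X : Set} {xs ys : List X} → Unique xs → xs ⊆ ys → length xs ℕ.≤ length ys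
length-⊆ uniq xs⊆ys = length-≤ _≡_ (λ p q → trans p (sym q)) uniq (λ x∈ → _ , xs⊆ys x∈ , refl)

infixl 6 _+ᵥ_ _-ᵥ_

_+ᵥ_ _-ᵥ_ : ∀ {d} → Lattice d → Lattice d → Lattice d
_+ᵥ_ = zipWith ℤ._+_
_-ᵥ_ = zipWith ℤ._-_

module _ {d : ℕ} where

  open DecMembership (_≟_ {d}) public using (_∈?_)

  card-unique : (X : FiniteSet d) → Unique (deduplicate _≟_ X)
  card-unique = Dedup.deduplicate-! _≟_

  ∈-dedup⁺ : ∀ {X : FiniteSet d} {x} → x ∈ X → x ∈ deduplicate _≟_ X
  ∈-dedup⁺ = ∈.∈-deduplicate⁺ _≟_

  ∈-dedup⁻ : ∀ (X : FiniteSet d) {x} → x ∈ deduplicate _≟_ X → x ∈ X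
  ∈-dedup⁻ = ∈.∈-deduplicate⁻ _≟_

∣∣-≤ : ∀ {d e} {X : FiniteSet d} {Y : FiniteSet e} (R : Lattice d → Lattice e → Set) →
  (∀ {x x′ y} → R x y → R x′ y → x ≡ x′) → (∀ {x} → x ∈ X → ∃ λ y → y ∈ Y × R x y) →
  ∣ X ∣ ℕ.≤ ∣ Y ∣
∣∣-≤ {X = X} R inj f = length-≤ R inj (card-unique X) λ x∈ →
  let y , y∈ , r = f (∈-dedup⁻ X x∈) in y , ∈-dedup⁺ y∈ , r

sub-cancel : ∀ {d} (x y : Lattice d) → x +ᵥ y -ᵥ x ≡ y
sub-cancel []       []       = refl
sub-cancel (x ∷ xs) (y ∷ ys) = cong₂ _∷_ (lemma x y) (sub-cancel xs ys)
  where
  lemma : ∀ x y → x ℤ.+ y ℤ.- x ≡ y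
  lemma = ℤ-Solver.solve-∀

add-cancel : ∀ {d} (x y : Lattice d) → x +ᵥ (y -ᵥ x) ≡ y
add-cancel []       []       = refl
add-cancel (x ∷ xs) (y ∷ ys) = cong₂ _∷_ (lemma x y) (add-cancel xs ys)
  where
  lemma : ∀ x y → x ℤ.+ (y ℤ.- x) ≡ y
  lemma = ℤ-Solver.solve-∀

sub-swap : ∀ {d} (x y z : Lattice d) → x -ᵥ y -ᵥ z ≡ x -ᵥ z -ᵥ y
sub-swap []       []       []       = refl
sub-swap (x ∷ xs) (y ∷ ys) (z ∷ zs) = cong₂ _∷_ (lemma x y z) (sub-swap xs ys zs)
  where
  lemma : ∀ x y z → x ℤ.- y ℤ.- z ≡ x ℤ.- z ℤ.- y
  lemma = ℤ-Solver.solve-∀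

sub-injective : ∀ {d} (v : Lattice d) {x y} → x -ᵥ v ≡ y -ᵥ v → x ≡ y
sub-injective v {x} {y} eq = trans (sym (add-cancel v x)) (trans (cong (v +ᵥ_) eq) (add-cancel v y))

sumOver : {X : Set} → (X → ℤ) → List X → ℤ
sumOver f []       = 0ℤ
sumOver f (x ∷ xs) = f x ℤ.+ sumOver f xs

sumOver-- : ∀ {X : Set} (f g : X → ℤ) xs →
  sumOver (λ x → f x ℤ.- g x) xs ≡ sumOver f xs ℤ.- sumOver g xs
sumOver-- f g []       = refl
sumOver-- f g (x ∷ xs) = trans (cong (λ s → f x ℤ.- g x ℤ.+ s) (sumOver-- f g xs)) (lemma (f x) (g x) _ _)
  where
  lemma : ∀ a b c d → a ℤ.- b ℤ.+ (c ℤ.- d) ≡ a ℤ.+ c ℤ.- (b ℤ.+ d)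
  lemma = ℤ-Solver.solve-∀

sumOver-map : ∀ {X Y : Set} (f : Y → ℤ) (g : X → Y) xs → sumOver f (List.map g xs) ≡ sumOver (f ∘ g) xs
sumOver-map f g []       = refl
sumOver-map f g (x ∷ xs) = cong (λ s → f (g x) ℤ.+ s) (sumOver-map f g xs)

sumOver-zero : ∀ {X : Set} (f : X → ℤ) xs → (∀ {x} → x ∈ xs → f x ≡ 0ℤ) → sumOver f xs ≡ 0ℤ
sumOver-zero f []       _  = refl
sumOver-zero f (x ∷ xs) f0 = cong₂ ℤ._+_ (f0 (here refl)) (sumOver-zero f xs (f0 ∘ there))

differences : ℕ → (ℕ → ℤ) → ℕ → ℤ
differences zero    f k = f k
differences (suc j) f k = differences j f (suc k) ℤ.- differences j f k

module AlternatingSums {d : ℕ} (B : FiniteSet d) where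

  N : ℕ → ℤ
  N h = + ∣ h · B ∣

  χ : ℕ → Lattice d → ℤ
  χ k x = if does (x ∈? k · B) then 1ℤ else 0ℤ

  χ-cong : ∀ {k l x y} → (x ∈ k · B → y ∈ l · B) → (y ∈ l · B → x ∈ k · B) → χ k x ≡ χ l y
  χ-cong {k} {l} {x} {y} f g with x ∈? k · B | y ∈? l · B
  ... | yes _ | yes _ = refl
  ... | no  _ | no  _ = refl
  ... | yes p | no ¬q = ⊥-elim (¬q (f p))
  ... | no ¬p | yes q = ⊥-elim (¬p (g q))

  -- The alternating sum of χ (k + length vs - ∣I∣) (x - v_I) over the sublists I of vs,
  -- where v_I is the sum of I.

  alt : List (Lattice d) → ℕ → Lattice d → ℤ
  alt []       k x = χ k x
  alt (v ∷ vs) k x = alt vs (suc k) x ℤ.- alt vs k (x -ᵥ v)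

  sum-χ : ∀ k X → Unique X → k · B ⊆ X → sumOver (χ k) X ≡ N k
  sum-χ k X uniq kB⊆X = trans (count X) (cong +_ (ℕ.≤-antisym
    (length-⊆ (Unique.filter⁺ (_∈? k · B) uniq) λ x∈ → ∈-dedup⁺ (proj₂ (∈.∈-filter⁻ (_∈? k · B) {xs = X} x∈)))
    (length-⊆ (card-unique (k · B)) λ x∈ →
      let x∈kB = ∈-dedup⁻ (k · B) x∈ in ∈.∈-filter⁺ (_∈? k · B) (kB⊆X x∈kB) x∈kB)))
    where
    count : ∀ X → sumOver (χ k) X ≡ + length (filter (_∈? k · B) X)
    count []      = refl
    count (x ∷ X) with x ∈? k · B
    ... | yes _ = cong ℤ.suc (count X)
    ... | no  _ = trans (ℤ.+-identityˡ _) (count X)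

  -- The ambient set `X` has to vary in the induction: the subtracted terms sum over `X` translated
  -- by `-v`, which still contains the next smaller sumset because `v` lies in `B`.
  sum-alt : ∀ vs k X → All (_∈ B) vs → Unique X → (length vs ℕ.+ k) · B ⊆ X →
    sumOver (alt vs k) X ≡ differences (length vs) N k
  sum-alt []       k X []          uniq kB⊆X = sum-χ k X uniq kB⊆X
  sum-alt (v ∷ vs) k X (v∈B ∷ vs∈B) uniq kB⊆X = begin
    sumOver (λ x → alt vs (suc k) x ℤ.- alt vs k (x -ᵥ v)) X
      ≡⟨ sumOver-- (alt vs (suc k)) (λ x → alt vs k (x -ᵥ v)) X ⟩
    sumOver (alt vs (suc k)) X ℤ.- sumOver (alt vs k ∘ (_-ᵥ v)) X
      ≡⟨ cong₂ ℤ._-_ (sum-alt vs (suc k) X vs∈B uniq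
                       (subst (λ j → j · B ⊆ X) (sym (ℕ.+-suc (length vs) k)) kB⊆X))
                     (trans (sym (sumOver-map (alt vs k) (_-ᵥ v) X))
                       (sum-alt vs k (List.map (_-ᵥ v) X) vs∈B
                         (Unique.map⁺ (sub-injective v) uniq) shifted)) ⟩
    differences (length vs) N (suc k) ℤ.- differences (length vs) N k ∎
    where
    open ≡-Reasoning
    shifted : (length vs ℕ.+ k) · B ⊆ List.map (_-ᵥ v) X
    shifted {y} y∈ = subst (_∈ List.map (_-ᵥ v) X) (sub-cancel v y)
      (∈.∈-map⁺ (_-ᵥ v) (kB⊆X (∈.∈-cartesianProductWith⁺ _+ᵥ_ v∈B y∈)))

  module _ (v : Lattice d) (P : Lattice d → Set)
           (toggle : ∀ k {y} → P y → χ (suc k) y ≡ χ k (y -ᵥ v)) where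

    Preserves : Lattice d → Set
    Preserves w = ∀ {y} → P y → P (y -ᵥ w)

    -- Subtracting `w` keeps `P` and commutes with subtracting `v`, so `toggle` applies at every
    -- leaf of the alternating sum.
    alt-toggle : ∀ ws k {y} → All Preserves ws → P y → alt ws (suc k) y ≡ alt ws k (y -ᵥ v)
    alt-toggle []       k pres Py = toggle k Py
    alt-toggle (w ∷ ws) k {y} (presw ∷ pres) Py = cong₂ ℤ._-_ (alt-toggle ws (suc k) pres Py)
      (trans (alt-toggle ws k pres (presw Py)) (cong (alt ws k) (sub-swap y w v)))

    -- Expanding along `us` brings `v` to the front, where the terms with and without `v` are equal
    -- by `alt-toggle`.
    alt-vanish : ∀ us ws k {y} → All Preserves us → All Preserves ws → P y →
      alt (us ++ v ∷ ws) k y ≡ 0ℤ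
    alt-vanish [] ws k {y} _ pres Py = ℤ.i≡j⇒i-j≡0 (alt-toggle ws k pres Py)
    alt-vanish (u ∷ us) ws k (presu ∷ presus) pres Py =
      cong₂ ℤ._-_ (alt-vanish us ws (suc k) presus pres Py) (alt-vanish us ws k presus pres (presu Py))

-- Newton interpolation

ℚ-ring : AlmostCommutativeRing 0ℓ 0ℓ
ℚ-ring = fromCommutativeRing ℚ.+-*-commutativeRing (dec⇒maybe ∘ (0ℚ ℚ.≟_))

-- The fraction `i / 1` is normalised by a gcd and does not compute for a variable `i`. The
-- arithmetic of `fromℤ` is therefore checked on unnormalised representatives.
toℚᵘ-fromℤ : ∀ i → toℚᵘ (fromℤ i) ℚᵘ.≃ mkℚᵘ i 0
toℚᵘ-fromℤ i = ℚ.toℚᵘ-fromℚᵘ (mkℚᵘ i 0)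

fromℤ-+ : ∀ i j → fromℤ (i ℤ.+ j) ≡ fromℤ i + fromℤ j
fromℤ-+ i j = ℚ.toℚᵘ-injective (begin
  toℚᵘ (fromℤ (i ℤ.+ j))              ≈⟨ toℚᵘ-fromℤ (i ℤ.+ j) ⟩
  mkℚᵘ (i ℤ.+ j) 0                    ≈⟨ *≡* (lemma i j) ⟩
  mkℚᵘ i 0 ℚᵘ.+ mkℚᵘ j 0              ≈⟨ ℚᵘ.+-cong (toℚᵘ-fromℤ i) (toℚᵘ-fromℤ j) ⟨
  toℚᵘ (fromℤ i) ℚᵘ.+ toℚᵘ (fromℤ j)  ≈⟨ ℚ.toℚᵘ-homo-+ (fromℤ i) (fromℤ j) ⟨
  toℚᵘ (fromℤ i + fromℤ j)            ∎)
  where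
  open ℚᵘ.≃-Reasoning
  lemma : ∀ i j → (i ℤ.+ j) ℤ.* 1ℤ ≡ (i ℤ.* 1ℤ ℤ.+ j ℤ.* 1ℤ) ℤ.* 1ℤ
  lemma = ℤ-Solver.solve-∀

fromℤ-* : ∀ i j → fromℤ (i ℤ.* j) ≡ fromℤ i * fromℤ j
fromℤ-* i j = ℚ.toℚᵘ-injective (begin
  toℚᵘ (fromℤ (i ℤ.* j))              ≈⟨ toℚᵘ-fromℤ (i ℤ.* j) ⟩
  mkℚᵘ (i ℤ.* j) 0                    ≈⟨ *≡* refl ⟩
  mkℚᵘ i 0 ℚᵘ.* mkℚᵘ j 0              ≈⟨ ℚᵘ.*-cong (toℚᵘ-fromℤ i) (toℚᵘ-fromℤ j) ⟨
  toℚᵘ (fromℤ i) ℚᵘ.* toℚᵘ (fromℤ j)  ≈⟨ ℚ.toℚᵘ-homo-* (fromℤ i) (fromℤ j) ⟨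
  toℚᵘ (fromℤ i * fromℤ j)            ∎)
  where open ℚᵘ.≃-Reasoning

fromℤ-neg : ∀ i → fromℤ (ℤ.- i) ≡ - fromℤ i
fromℤ-neg i = begin
  fromℤ (ℤ.- i)                          ≡⟨ lemma _ (fromℤ i) ⟩
  fromℤ (ℤ.- i) + fromℤ i - fromℤ i      ≡⟨ cong (_- fromℤ i) (fromℤ-+ (ℤ.- i) i) ⟨
  fromℤ (ℤ.- i ℤ.+ i) - fromℤ i          ≡⟨ cong (λ k → fromℤ k - fromℤ i) (ℤ.+-inverseˡ i) ⟩
  0ℚ - fromℤ i                           ≡⟨ ℚ.+-identityˡ _ ⟩
  - fromℤ i                              ∎
  where
  open ≡-Reasoning
  lemma : ∀ x y → x ≡ x + y - y
  lemma = ℚ-Solver.solve-∀ ℚ-ring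

fromℤ-- : ∀ i j → fromℤ (i ℤ.- j) ≡ fromℤ i - fromℤ j
fromℤ-- i j = trans (fromℤ-+ i (ℤ.- j)) (cong (λ z → fromℤ i + z) (fromℤ-neg j))

fromℤ-injective : ∀ {i j} → fromℤ i ≡ fromℤ j → i ≡ j
fromℤ-injective {i} {j} eq = trans (sym (ℤ.*-identityʳ i)) (trans
  (ℚᵘ.drop-*≡* (ℚᵘ.≃-trans (ℚᵘ.≃-sym (toℚᵘ-fromℤ i)) (ℚᵘ.≃-trans (ℚ.toℚᵘ-cong eq) (toℚᵘ-fromℤ j))))
  (ℤ.*-identityʳ j))

fromℤ-mono-≤ : ∀ {i j} → i ℤ.≤ j → fromℤ i ≤ fromℤ j
fromℤ-mono-≤ {i} {j} i≤j = ℚ.toℚᵘ-cancel-≤ (begin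
  toℚᵘ (fromℤ i)  ≃⟨ toℚᵘ-fromℤ i ⟩
  mkℚᵘ i 0        ≤⟨ ℚᵘ.*≤* (ℤ.*-monoʳ-≤-nonNeg 1ℤ i≤j) ⟩
  mkℚᵘ j 0        ≃⟨ toℚᵘ-fromℤ j ⟨
  toℚᵘ (fromℤ j)  ∎)
  where open ℚᵘ.≤-Reasoning

fromℤ-cancel-≤ : ∀ {i j} → fromℤ i ≤ fromℤ j → i ℤ.≤ j
fromℤ-cancel-≤ {i} {j} le = ℤ.*-cancelʳ-≤-pos i j 1ℤ (ℚᵘ.drop-*≤* (begin
  mkℚᵘ i 0        ≃⟨ toℚᵘ-fromℤ i ⟨
  toℚᵘ (fromℤ i)  ≤⟨ ℚ.toℚᵘ-mono-≤ le ⟩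
  toℚᵘ (fromℤ j)  ≃⟨ toℚᵘ-fromℤ j ⟩
  mkℚᵘ j 0        ∎))
  where open ℚᵘ.≤-Reasoning

fromℤ-cancel-< : ∀ {i j} → fromℤ i < fromℤ j → i ℤ.< j
fromℤ-cancel-< {i} {j} lt = ℤ.≰⇒> λ j≤i → ℚ.<-irrefl refl (ℚ.<-≤-trans lt (fromℤ-mono-≤ j≤i))

/-*-cancel : ∀ i n .{{_ : ℕ.NonZero n}} → (i / n) * fromℕ n ≡ fromℤ i
/-*-cancel i n@(suc n-1) = ℚ.toℚᵘ-injective (begin
  toℚᵘ ((i / n) * fromℕ n)            ≈⟨ ℚ.toℚᵘ-homo-* (i / n) (fromℕ n) ⟩
  toℚᵘ (i / n) ℚᵘ.* toℚᵘ (fromℕ n)    ≈⟨ ℚᵘ.*-cong (ℚ.toℚᵘ-fromℚᵘ (mkℚᵘ i n-1)) (toℚᵘ-fromℤ (+ n)) ⟩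
  mkℚᵘ i n-1 ℚᵘ.* mkℚᵘ (+ n) 0        ≈⟨ *≡* (trans (ℤ.*-identityʳ _)
                                           (cong (λ k → i ℤ.* + k) (sym (ℕ.*-identityʳ n)))) ⟩
  mkℚᵘ i 0                            ≈⟨ toℚᵘ-fromℤ i ⟨
  toℚᵘ (fromℤ i)                      ∎)
  where open ℚᵘ.≃-Reasoning

fromℕ-suc : ∀ n → fromℕ (suc n) ≡ 1ℚ + fromℕ n
fromℕ-suc n = fromℤ-+ 1ℤ (+ n)

infixl 6 _+ₚ_

_+ₚ_ : ℚ[x] → ℚ[x] → ℚ[x]
[]       +ₚ q        = q
p        +ₚ []       = p
(a ∷ p)  +ₚ (b ∷ q)  = (a + b) ∷ (p +ₚ q)

eval-+ₚ : ∀ p q x → eval (p +ₚ q) x ≡ eval p x + eval q x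
eval-+ₚ []      q       x = sym (ℚ.+-identityˡ _)
eval-+ₚ (a ∷ p) []      x = sym (ℚ.+-identityʳ _)
eval-+ₚ (a ∷ p) (b ∷ q) x = trans (cong (λ z → a + b + x * z) (eval-+ₚ p q x)) (lemma a b x _ _)
  where
  lemma : ∀ a b x y z → a + b + x * (y + z) ≡ a + x * y + (b + x * z)
  lemma = ℚ-Solver.solve-∀ ℚ-ring

infixr 7 _·ₚ_

_·ₚ_ : ℚ → ℚ[x] → ℚ[x]
c ·ₚ p = List.map (c *_) p

eval-·ₚ : ∀ c p x → eval (c ·ₚ p) x ≡ c * eval p x
eval-·ₚ c []      x = sym (ℚ.*-zeroʳ c)
eval-·ₚ c (a ∷ p) x = trans (cong (λ z → c * a + x * z) (eval-·ₚ c p x)) (lemma c a x _)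
  where
  lemma : ∀ c a x y → c * a + x * (c * y) ≡ c * (a + x * y)
  lemma = ℚ-Solver.solve-∀ ℚ-ring

-- binomial j represents the polynomial x (x - 1) ... (x - j + 1) / j!.

binomial : ℕ → ℚ[x]
binomial zero    = 1ℚ ∷ []
binomial (suc j) = (1ℤ / suc j) ·ₚ ((0ℚ ∷ binomial j) +ₚ (- fromℕ j) ·ₚ binomial j)

eval-binomial-suc : ∀ j x →
  eval (binomial (suc j)) x ≡ (1ℤ / suc j) * ((x - fromℕ j) * eval (binomial j) x)
eval-binomial-suc j x = begin
  eval (binomial (suc j)) x
    ≡⟨ eval-·ₚ (1ℤ / suc j) ((0ℚ ∷ binomial j) +ₚ (- fromℕ j) ·ₚ binomial j) x ⟩
  r * eval ((0ℚ ∷ binomial j) +ₚ (- fromℕ j) ·ₚ binomial j) x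
    ≡⟨ cong (r *_) (eval-+ₚ (0ℚ ∷ binomial j) ((- fromℕ j) ·ₚ binomial j) x) ⟩
  r * (0ℚ + x * b + eval ((- fromℕ j) ·ₚ binomial j) x)
    ≡⟨ cong (λ z → r * (0ℚ + x * b + z)) (eval-·ₚ (- fromℕ j) (binomial j) x) ⟩
  r * (0ℚ + x * b + - fromℕ j * b)
    ≡⟨ lemma r x b (fromℕ j) ⟩
  r * ((x - fromℕ j) * b) ∎
  where
  open ≡-Reasoning
  r = 1ℤ / suc j
  b = eval (binomial j) x
  lemma : ∀ r x b c → r * (0ℚ + x * b + - c * b) ≡ r * ((x - c) * b)
  lemma = ℚ-Solver.solve-∀ ℚ-ring

-- Pascal's rule as an identity at every rational `x`. The step isolates the difference `b⁺ - b`,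
-- which the previous case evaluates, and then uses that (x - j) times the j-th binomial is j + 1
-- times the next one; this leaves `b` multiplied by (j + 2) / (j + 2).
binomial-pascal : ∀ j x →
  eval (binomial (suc j)) (1ℚ + x) - eval (binomial (suc j)) x ≡ eval (binomial j) x
binomial-pascal zero x = trans
  (cong₂ _-_ (eval-binomial-suc 0 (1ℚ + x)) (eval-binomial-suc 0 x)) (lemma x)
  where
  lemma : ∀ x → 1ℚ * ((1ℚ + x - 0ℚ) * (1ℚ + (1ℚ + x) * 0ℚ)) - 1ℚ * ((x - 0ℚ) * (1ℚ + x * 0ℚ)) ≡ 1ℚ + x * 0ℚ
  lemma = ℚ-Solver.solve-∀ ℚ-ring
binomial-pascal (suc j) x = begin
  eval (binomial (2 ℕ.+ j)) (1ℚ + x) - eval (binomial (2 ℕ.+ j)) x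
    ≡⟨ cong₂ _-_ (eval-binomial-suc (suc j) (1ℚ + x)) (eval-binomial-suc (suc j) x) ⟩
  r * ((1ℚ + x - fromℕ (suc j)) * b⁺) - r * ((x - fromℕ (suc j)) * b)
    ≡⟨ cong (λ z → r * ((1ℚ + x - z) * b⁺) - r * ((x - z) * b)) (fromℕ-suc j) ⟩
  r * ((1ℚ + x - (1ℚ + c)) * b⁺) - r * ((x - (1ℚ + c)) * b)
    ≡⟨ lemma₁ r x c b⁺ b ⟩
  r * ((x - c) * (b⁺ - b) + b)
    ≡⟨ cong (λ z → r * ((x - c) * z + b)) (binomial-pascal j x) ⟩
  r * (y + b)
    ≡⟨ cong (λ z → r * (z + b)) (trans (sym (ℚ.*-identityˡ y)) (trans (cong (_* y) (sym inv-j)) (lemma₂ s (1ℚ + c) y))) ⟩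
  r * ((1ℚ + c) * (s * y) + b)
    ≡⟨ cong (λ z → r * ((1ℚ + c) * z + b)) (eval-binomial-suc j x) ⟨
  r * ((1ℚ + c) * b + b)
    ≡⟨ lemma₃ r c b ⟩
  r * (1ℚ + (1ℚ + c)) * b
    ≡⟨ cong (_* b) inv-sj ⟩
  1ℚ * b
    ≡⟨ ℚ.*-identityˡ b ⟩
  b ∎
  where
  open ≡-Reasoning
  r = 1ℤ / suc (suc j)
  s = 1ℤ / suc j
  c = fromℕ j
  a = eval (binomial j) x
  y = (x - c) * a
  b⁺ = eval (binomial (suc j)) (1ℚ + x)
  b = eval (binomial (suc j)) x
  inv-j : s * (1ℚ + c) ≡ 1ℚ
  inv-j = trans (cong (s *_) (sym (fromℕ-suc j))) (/-*-cancel 1ℤ (suc j))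
  inv-sj : r * (1ℚ + (1ℚ + c)) ≡ 1ℚ
  inv-sj = trans (cong (r *_) (sym (trans (fromℕ-suc (suc j)) (cong (λ z → 1ℚ + z) (fromℕ-suc j))))) (/-*-cancel 1ℤ (suc (suc j)))
  lemma₁ : ∀ r x c b⁺ b → r * ((1ℚ + x - (1ℚ + c)) * b⁺) - r * ((x - (1ℚ + c)) * b) ≡ r * ((x - c) * (b⁺ - b) + b)
  lemma₁ = ℚ-Solver.solve-∀ ℚ-ring
  lemma₂ : ∀ s c y → s * c * y ≡ c * (s * y)
  lemma₂ = ℚ-Solver.solve-∀ ℚ-ring
  lemma₃ : ∀ r c b → r * ((1ℚ + c) * b + b) ≡ r * (1ℚ + (1ℚ + c)) * b
  lemma₃ = ℚ-Solver.solve-∀ ℚ-ring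

-- A Newton series whose coefficients belong to the binomials of index `o`, `o + 1`, and so on. With
-- the offset as a parameter, taking a difference amounts to lowering `o` by one.
newton : ℕ → List ℚ → ℚ[x]
newton o []       = []
newton o (c ∷ cs) = c ·ₚ binomial o +ₚ newton (suc o) cs

eval-newton-∷ : ∀ o c cs x →
  eval (newton o (c ∷ cs)) x ≡ c * eval (binomial o) x + eval (newton (suc o) cs) x
eval-newton-∷ o c cs x = trans (eval-+ₚ (c ·ₚ binomial o) _ x) (cong (_+ _) (eval-·ₚ c (binomial o) x))

newton-difference : ∀ o cs x →
  eval (newton (suc o) cs) (1ℚ + x) - eval (newton (suc o) cs) x ≡ eval (newton o cs) x
newton-difference o []       x = refl
newton-difference o (c ∷ cs) x = begin
  eval (newton (suc o) (c ∷ cs)) (1ℚ + x) - eval (newton (suc o) (c ∷ cs)) x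
    ≡⟨ cong₂ _-_ (eval-newton-∷ (suc o) c cs (1ℚ + x)) (eval-newton-∷ (suc o) c cs x) ⟩
  c * b⁺ + n⁺ - (c * b + n)
    ≡⟨ lemma c b⁺ n⁺ b n ⟩
  c * (b⁺ - b) + (n⁺ - n)
    ≡⟨ cong₂ (λ y z → c * y + z) (binomial-pascal o x) (newton-difference (suc o) cs x) ⟩
  c * eval (binomial o) x + eval (newton (suc o) cs) x
    ≡⟨ eval-newton-∷ o c cs x ⟨
  eval (newton o (c ∷ cs)) x ∎
  where
  open ≡-Reasoning
  b⁺ = eval (binomial (suc o)) (1ℚ + x)
  b  = eval (binomial (suc o)) x
  n⁺ = eval (newton (suc (suc o)) cs) (1ℚ + x)
  n  = eval (newton (suc (suc o)) cs) x
  lemma : ∀ c b⁺ n⁺ b n → c * b⁺ + n⁺ - (c * b + n) ≡ c * (b⁺ - b) + (n⁺ - n)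
  lemma = ℚ-Solver.solve-∀ ℚ-ring

differences-suc : ∀ j f k → differences (suc j) f k ≡ differences j (differences 1 f) k
differences-suc zero    f k = refl
differences-suc (suc j) f k = cong₂ ℤ._-_ (differences-suc j f (suc k)) (differences-suc j f k)

-- Discrete integration: the coefficients for the difference of `f` are moved up by one index, and
-- the new constant term `c` is chosen to fit the value at `T`. Agreement then propagates upwards
-- from `T`, since both sides have the same difference.
newton-expansion : ∀ j T (f : ℕ → ℤ) → (∀ h → T ℕ.≤ h → differences j f h ≡ 0ℤ) →
  ∃ λ cs → ∀ h → T ℕ.≤ h → fromℤ (f h) ≡ eval (newton 0 cs) (fromℕ h)
newton-expansion zero    T f zeros = [] , λ h T≤h → cong fromℤ (zeros h T≤h)
newton-expansion (suc j) T f zeros with newton-expansion j T (differences 1 f)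
    (λ h T≤h → trans (sym (differences-suc j f h)) (zeros h T≤h))
... | cs , Δf = (c ∷ cs) , λ h T≤h → subst (λ k → fromℤ (f k) ≡ E k) (ℕ.m∸n+n≡m T≤h) (main (h ℕ.∸ T))
  where
  open ≡-Reasoning
  E₁ E : ℕ → ℚ
  E₁ h = eval (newton 1 cs) (fromℕ h)
  c = fromℤ (f T) - E₁ T
  E h = eval (newton 0 (c ∷ cs)) (fromℕ h)
  E≡ : ∀ h → E h ≡ c + E₁ h
  E≡ h = trans (eval-newton-∷ 0 c cs (fromℕ h)) (cong (_+ E₁ h) (lemma c (fromℕ h)))
    where
    lemma : ∀ c x → c * (1ℚ + x * 0ℚ) ≡ c
    lemma = ℚ-Solver.solve-∀ ℚ-ring
  main : ∀ k → fromℤ (f (k ℕ.+ T)) ≡ E (k ℕ.+ T)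
  main zero = trans (lemma _ (E₁ T)) (sym (E≡ T))
    where
    lemma : ∀ x y → x ≡ x - y + y
    lemma = ℚ-Solver.solve-∀ ℚ-ring
  main (suc k) = begin
    fromℤ (f (suc h))
      ≡⟨ lemma₁ _ (fromℤ (f h)) ⟩
    fromℤ (f (suc h)) - fromℤ (f h) + fromℤ (f h)
      ≡⟨ cong₂ _+_ (trans (sym (fromℤ-- (f (suc h)) (f h))) (Δf h (ℕ.m≤n+m T k))) (trans (main k) (E≡ h)) ⟩
    eval (newton 0 cs) (fromℕ h) + (c + E₁ h)
      ≡⟨ cong (_+ (c + E₁ h)) (newton-difference 0 cs (fromℕ h)) ⟨
    eval (newton 1 cs) (1ℚ + fromℕ h) - E₁ h + (c + E₁ h)
      ≡⟨ lemma₂ _ (E₁ h) c ⟩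
    c + eval (newton 1 cs) (1ℚ + fromℕ h)
      ≡⟨ cong (λ x → c + eval (newton 1 cs) x) (fromℕ-suc h) ⟨
    c + E₁ (suc h)
      ≡⟨ E≡ (suc h) ⟨
    E (suc h) ∎
    where
    h = k ℕ.+ T
    lemma₁ : ∀ x y → x ≡ x - y + y
    lemma₁ = ℚ-Solver.solve-∀ ℚ-ring
    lemma₂ : ∀ x y c → x - y + (c + y) ≡ c + x
    lemma₂ = ℚ-Solver.solve-∀ ℚ-ring

eventually-polynomial : ∀ j T (f : ℕ → ℤ) → (∀ h → T ℕ.≤ h → differences j f h ≡ 0ℤ) →
  ∃ λ p → ∀ h → T ℕ.≤ h → fromℤ (f h) ≡ eval p (fromℕ h)
eventually-polynomial j T f zeros = let cs , eq = newton-expansion j T f zeros in newton 0 cs , eq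

-- Integer vectors

module _ {d : ℕ} where

  +ᵥ-identityˡ : (x : Lattice d) → origin +ᵥ x ≡ x
  +ᵥ-identityˡ = Vec.zipWith-identityˡ ℤ.+-identityˡ

  +ᵥ-identityʳ : (x : Lattice d) → x +ᵥ origin ≡ x
  +ᵥ-identityʳ = Vec.zipWith-identityʳ ℤ.+-identityʳ

  +ᵥ-assoc : (x y z : Lattice d) → x +ᵥ y +ᵥ z ≡ x +ᵥ (y +ᵥ z)
  +ᵥ-assoc = Vec.zipWith-assoc ℤ.+-assoc

  +ᵥ-comm : (x y : Lattice d) → x +ᵥ y ≡ y +ᵥ x
  +ᵥ-comm = Vec.zipWith-comm ℤ.+-comm

  +ᵥ-swap : (x y z : Lattice d) → x +ᵥ (y +ᵥ z) ≡ y +ᵥ (x +ᵥ z)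
  +ᵥ-swap x y z = trans (sym (+ᵥ-assoc x y z)) (trans (cong (_+ᵥ z) (+ᵥ-comm x y)) (+ᵥ-assoc y x z))

  ∑ : List (Lattice d) → Lattice d
  ∑ = List.foldr _+ᵥ_ origin

  ∑-++ : ∀ xs ys → ∑ (xs ++ ys) ≡ ∑ xs +ᵥ ∑ ys
  ∑-++ []       ys = sym (+ᵥ-identityˡ _)
  ∑-++ (x ∷ xs) ys = trans (cong (x +ᵥ_) (∑-++ xs ys)) (sym (+ᵥ-assoc x _ _))

  ∑-insert : ∀ xs y ys → ∑ (xs ++ y ∷ ys) ≡ y +ᵥ ∑ (xs ++ ys)
  ∑-insert []       y ys = refl
  ∑-insert (x ∷ xs) y ys = trans (cong (x +ᵥ_) (∑-insert xs y ys)) (+ᵥ-swap x y _)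

  module _ {B : FiniteSet d} where

    ∑∈· : ∀ {bs} → All (_∈ B) bs → ∑ bs ∈ length bs · B
    ∑∈· []           = here refl
    ∑∈· (b∈B ∷ bs∈B) = ∈.∈-cartesianProductWith⁺ _+ᵥ_ b∈B (∑∈· bs∈B)

    ∈·⇒∑ : ∀ k {x} → x ∈ k · B → ∃ λ bs → All (_∈ B) bs × length bs ≡ k × x ≡ ∑ bs
    ∈·⇒∑ zero    (here refl) = [] , [] , refl , refl
    ∈·⇒∑ (suc k) x∈ with ∈.∈-cartesianProductWith⁻ _+ᵥ_ B (k · B) x∈
    ... | b , y , b∈B , y∈kB , refl with ∈·⇒∑ k y∈kB
    ... | bs , bs∈B , len , refl = b ∷ bs , b∈B ∷ bs∈B , cong suc len , refl

Nonneg : ∀ {n} → Lattice n → Set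
Nonneg x = ∀ i → 0ℤ ℤ.≤ lookup x i

total : ∀ {n} → Lattice n → ℤ
total = Vec.foldr′ ℤ._+_ 0ℤ

total-+ᵥ : ∀ {n} (x y : Lattice n) → total (x +ᵥ y) ≡ total x ℤ.+ total y
total-+ᵥ []       []       = refl
total-+ᵥ (a ∷ x) (b ∷ y) = trans (cong (λ s → a ℤ.+ b ℤ.+ s) (total-+ᵥ x y)) (lemma a b (total x) (total y))
  where
  lemma : ∀ a b s t → a ℤ.+ b ℤ.+ (s ℤ.+ t) ≡ a ℤ.+ s ℤ.+ (b ℤ.+ t)
  lemma = ℤ-Solver.solve-∀

total-origin : ∀ n → total (origin {n}) ≡ 0ℤ
total-origin zero    = refl
total-origin (suc n) = trans (ℤ.+-identityˡ _) (total-origin n)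

0≤total : ∀ {n} (x : Lattice n) → Nonneg x → 0ℤ ℤ.≤ total x
0≤total []      _ = ℤ.≤-refl
0≤total (a ∷ x) p = ℤ.+-mono-≤ (p zero) (0≤total x (p ∘ suc))

total-mono : ∀ {n} (x y : Lattice n) → (∀ i → lookup x i ℤ.≤ lookup y i) → total x ℤ.≤ total y
total-mono []      []      _ = ℤ.≤-refl
total-mono (a ∷ x) (b ∷ y) p = ℤ.+-mono-≤ (p zero) (total-mono x y (p ∘ suc))

total≡0⇒origin : ∀ {n} (x : Lattice n) → Nonneg x → total x ℤ.≤ 0ℤ → x ≡ origin
total≡0⇒origin []      _ _  = refl
total≡0⇒origin (a ∷ x) p le = cong₂ _∷_
  (ℤ.≤-antisym (ℤ.≤-trans (subst (ℤ._≤ a ℤ.+ total x) (ℤ.+-identityʳ a) (ℤ.+-monoʳ-≤ a (0≤total x (p ∘ suc)))) le) (p zero))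
  (total≡0⇒origin x (p ∘ suc)
    (ℤ.≤-trans (subst (ℤ._≤ a ℤ.+ total x) (ℤ.+-identityˡ _) (ℤ.+-monoˡ-≤ (total x) (p zero))) le))

-- All coordinates but the `i`-th may exceed those of `y` by `c`. The summand `c` on the left
-- accounts for the coordinate that does not and avoids the factor `n - 1`.
total-lower : ∀ {n} (x y : Lattice n) i c → (∀ j → lookup x j ℤ.≤ lookup y j ℤ.+ c) →
  lookup x i ℤ.≤ lookup y i → total x ℤ.+ c ℤ.≤ total y ℤ.+ + n ℤ.* c
total-lower {suc n} (a ∷ x) (b ∷ y) zero c p q = subst₂ ℤ._≤_ (lemma₁ a (total x) c) (lemma₂ b (total y) (+ n) c)
  (ℤ.+-mono-≤ (ℤ.+-monoˡ-≤ c q) (bound x y (p ∘ suc)))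
  where
  bound : ∀ {n} (x y : Lattice n) → (∀ j → lookup x j ℤ.≤ lookup y j ℤ.+ c) → total x ℤ.≤ total y ℤ.+ + n ℤ.* c
  bound []      []      _ = ℤ.≤-refl
  bound {suc n} (a ∷ x) (b ∷ y) p = subst (a ℤ.+ total x ℤ.≤_) (lemma b c (total y) (+ n)) (ℤ.+-mono-≤ (p zero) (bound x y (p ∘ suc)))
    where
    lemma : ∀ b c t m → b ℤ.+ c ℤ.+ (t ℤ.+ m ℤ.* c) ≡ b ℤ.+ t ℤ.+ (1ℤ ℤ.+ m) ℤ.* c
    lemma = ℤ-Solver.solve-∀
  lemma₁ : ∀ a t c → a ℤ.+ c ℤ.+ t ≡ a ℤ.+ t ℤ.+ c
  lemma₁ = ℤ-Solver.solve-∀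
  lemma₂ : ∀ b t m c → b ℤ.+ c ℤ.+ (t ℤ.+ m ℤ.* c) ≡ b ℤ.+ t ℤ.+ (1ℤ ℤ.+ m) ℤ.* c
  lemma₂ = ℤ-Solver.solve-∀
total-lower {suc n} (a ∷ x) (b ∷ y) (suc i) c p q = subst₂ ℤ._≤_ (sym (ℤ.+-assoc a _ c)) (lemma b (total y) (+ n) c)
  (ℤ.+-mono-≤ (p zero) (total-lower x y i c (p ∘ suc) q))
  where
  lemma : ∀ b t m c → b ℤ.+ c ℤ.+ (t ℤ.+ m ℤ.* c) ≡ b ℤ.+ t ℤ.+ (1ℤ ℤ.+ m) ℤ.* c
  lemma = ℤ-Solver.solve-∀

-- The coordinates other than the `i`-th are nonnegative and their sum is at most zero.
concentrated : ∀ {n} (x : Lattice n) i → Nonneg x → total x ℤ.≤ lookup x i → x ≡ origin [ i ]≔ total x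
concentrated {suc n} (a ∷ x) zero p le = cong₂ _∷_ (trans (sym (ℤ.+-identityʳ a)) (cong (λ z → a ℤ.+ z) (sym tx≡0))) x≡0
  where
  x≡0 : x ≡ origin
  x≡0 = total≡0⇒origin x (p ∘ suc) (subst₂ ℤ._≤_ (lemma₁ a (total x)) (lemma₂ a) (ℤ.+-monoʳ-≤ (ℤ.- a) le))
    where
    lemma₁ : ∀ a t → ℤ.- a ℤ.+ (a ℤ.+ t) ≡ t
    lemma₁ = ℤ-Solver.solve-∀
    lemma₂ : ∀ a → ℤ.- a ℤ.+ a ≡ 0ℤ
    lemma₂ = ℤ-Solver.solve-∀
  tx≡0 : total x ≡ 0ℤ
  tx≡0 = trans (cong total x≡0) (total-origin n)
concentrated (a ∷ x) (suc i) p le = cong₂ _∷_ a≡0 (trans (concentrated x i (p ∘ suc) tx≤) (cong (origin [ i ]≔_) tx≡))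
  where
  lookup≤total : ∀ {n} (x : Lattice n) i → Nonneg x → lookup x i ℤ.≤ total x
  lookup≤total (a ∷ x) zero    p = subst (ℤ._≤ a ℤ.+ total x) (ℤ.+-identityʳ a) (ℤ.+-monoʳ-≤ a (0≤total x (p ∘ suc)))
  lookup≤total (a ∷ x) (suc i) p = subst (ℤ._≤ a ℤ.+ total x) (ℤ.+-identityˡ _) (ℤ.+-mono-≤ (p zero) (lookup≤total x i (p ∘ suc)))
  tx≤ : total x ℤ.≤ lookup x i
  tx≤ = ℤ.≤-trans (subst (ℤ._≤ a ℤ.+ total x) (ℤ.+-identityˡ _) (ℤ.+-monoˡ-≤ (total x) (p zero))) le
  a≡0 : a ≡ 0ℤ
  a≡0 = ℤ.≤-antisym (subst₂ ℤ._≤_ (lemma₁ a (total x)) (lemma₂ (total x))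
          (ℤ.+-monoˡ-≤ (ℤ.- total x) (ℤ.≤-trans le (lookup≤total x i (p ∘ suc))))) (p zero)
    where
    lemma₁ : ∀ a t → a ℤ.+ t ℤ.+ ℤ.- t ≡ a
    lemma₁ = ℤ-Solver.solve-∀
    lemma₂ : ∀ t → t ℤ.+ ℤ.- t ≡ 0ℤ
    lemma₂ = ℤ-Solver.solve-∀
  tx≡ : total x ≡ a ℤ.+ total x
  tx≡ = trans (sym (ℤ.+-identityˡ _)) (cong (λ z → z ℤ.+ total x) (sym a≡0))

lookup-∑-≤ : ∀ {n} (i : Fin n) c bs → All (λ b → lookup b i ℤ.≤ c) bs → lookup (∑ bs) i ℤ.≤ + length bs ℤ.* c
lookup-∑-≤ i c []       []       = ℤ.≤-reflexive (Vec.lookup-replicate i 0ℤ)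
lookup-∑-≤ i c (b ∷ bs) (p ∷ ps) = subst₂ ℤ._≤_ (sym (Vec.lookup-zipWith ℤ._+_ i b (∑ bs))) (lemma c (+ length bs))
  (ℤ.+-mono-≤ p (lookup-∑-≤ i c bs ps))
  where
  lemma : ∀ c l → c ℤ.+ l ℤ.* c ≡ (1ℤ ℤ.+ l) ℤ.* c
  lemma = ℤ-Solver.solve-∀

nonneg-∑ : ∀ {n} {bs : List (Lattice n)} → All Nonneg bs → Nonneg (∑ bs)
nonneg-∑ []             i = ℤ.≤-reflexive (sym (Vec.lookup-replicate i 0ℤ))
nonneg-∑ {bs = b ∷ bs} (p ∷ ps) i = subst (0ℤ ℤ.≤_) (sym (Vec.lookup-zipWith ℤ._+_ i b (∑ bs)))
  (ℤ.+-mono-≤ (p i) (nonneg-∑ ps i))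

total-∑ : ∀ {n} c {bs : List (Lattice n)} → All (λ b → total b ≡ c) bs → total (∑ bs) ≡ + length bs ℤ.* c
total-∑ {n} c []           = total-origin n
total-∑ {n} c {b ∷ bs} (p ∷ ps) = trans (total-+ᵥ b (∑ bs)) (trans (cong₂ ℤ._+_ p (total-∑ c ps)) (lemma c (+ length bs)))
  where
  lemma : ∀ c l → c ℤ.+ l ℤ.* c ≡ (1ℤ ℤ.+ l) ℤ.* c
  lemma = ℤ-Solver.solve-∀

module Units (D : ℕ) .{{_ : ℕ.NonZero D}} where

  unit : ∀ {n} → Fin n → Lattice n
  unit i = origin [ i ]≔ + D

  units : ∀ {n} → List (Fin n) → Lattice n
  units js = ∑ (List.map unit js)

  Divisible : ∀ {n} → Lattice n → Set
  Divisible x = ∀ i → + D ∣ lookup x i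

  divisible? : ∀ {n} (x : Lattice n) → Dec (Divisible x)
  divisible? x = Fin.all? λ i → + D ∣? lookup x i

  divisible-+ : ∀ {n} (x y : Lattice n) → Divisible x → Divisible y → Divisible (x +ᵥ y)
  divisible-+ x y p q i = subst (+ D ∣_) (sym (Vec.lookup-zipWith ℤ._+_ i x y)) (∣.∣m∣n⇒∣m+n (p i) (q i))

  divisible-- : ∀ {n} (x y : Lattice n) → Divisible x → Divisible y → Divisible (x -ᵥ y)
  divisible-- x y p q i = subst (+ D ∣_) (sym (Vec.lookup-zipWith ℤ._-_ i x y)) (∣.∣m∣n⇒∣m-n (p i) (q i))

  divisible-origin : ∀ {n} → Divisible (origin {n})
  divisible-origin i = subst (+ D ∣_) (sym (Vec.lookup-replicate i 0ℤ)) (divides 0ℤ refl)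

  divisible-unit : ∀ {n} (j : Fin n) → Divisible (unit j)
  divisible-unit zero    zero    = ∣.∣-refl
  divisible-unit zero    (suc i) = divisible-origin i
  divisible-unit (suc j) zero    = divides 0ℤ refl
  divisible-unit (suc j) (suc i) = divisible-unit j i

  divisible-units : ∀ {n} (js : List (Fin n)) → Divisible (units js)
  divisible-units []       = divisible-origin
  divisible-units (j ∷ js) = divisible-+ (unit j) (units js) (divisible-unit j) (divisible-units js)

  units-suc : ∀ {n} (js : List (Fin n)) → units (List.map suc js) ≡ 0ℤ ∷ units js
  units-suc []       = refl
  units-suc (j ∷ js) = cong (unit (suc j) +ᵥ_) (units-suc js)

  units-replicate : ∀ {n} q a (x : Lattice n) → ∑ (List.replicate q (unit zero)) +ᵥ (a ∷ x) ≡ (+ q ℤ.* + D ℤ.+ a) ∷ x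
  units-replicate zero a x = trans (+ᵥ-identityˡ (a ∷ x)) (cong (_∷ x) (sym (ℤ.+-identityˡ a)))
  units-replicate (suc q) a x = trans (+ᵥ-assoc (unit zero) (∑ (List.replicate q (unit zero))) (a ∷ x))
    (trans (cong (unit zero +ᵥ_) (units-replicate q a x)) (cong₂ _∷_ (lemma (+ D) (+ q) a) (+ᵥ-identityˡ x)))
    where
    lemma : ∀ D q a → D ℤ.+ (q ℤ.* D ℤ.+ a) ≡ (1ℤ ℤ.+ q) ℤ.* D ℤ.+ a
    lemma = ℤ-Solver.solve-∀

  -- The quotient of each coordinate by `D` says how often its index occurs. The equation for
  -- `total` determines the number of units, so that trading a block of elements of `B` for units
  -- will preserve the number of summands.
  divisible⇒units : ∀ {n} (x : Lattice n) → Nonneg x → Divisible x →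
    ∃ λ js → units js ≡ x × total x ≡ + length js ℤ.* + D
  divisible⇒units []      _ _ = [] , refl , refl
  divisible⇒units (a ∷ x) p q with divisible⇒units x (p ∘ suc) (q ∘ suc) | q zero
  ... | js , eq , len | divides (ℤ.-[1+ k ]) a≡ = ⊥-elim (ℤ.<⇒≱
    (ℤ.*-monoʳ-<-pos (+ D) {{posD}} { ℤ.-[1+ k ]} {0ℤ} ℤ.-<+) (subst (0ℤ ℤ.≤_) a≡ (p zero)))
    where
    posD : ℤ.Positive (+ D)
    posD = ℤ.positive (ℤ.+<+ (ℕ.>-nonZero⁻¹ D))
  ... | js , eq , len | divides (+ q) a≡ = List.replicate q zero ++ List.map suc js
    , (begin
        ∑ (List.map unit (List.replicate q zero ++ List.map suc js))
          ≡⟨ cong ∑ (List.map-++ unit (List.replicate q zero) _) ⟩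
        ∑ (List.map unit (List.replicate q zero) ++ List.map unit (List.map suc js))
          ≡⟨ ∑-++ (List.map unit (List.replicate q zero)) _ ⟩
        ∑ (List.map unit (List.replicate q zero)) +ᵥ units (List.map suc js)
          ≡⟨ cong₂ (λ y z → ∑ y +ᵥ z) (List.map-replicate unit q zero) (trans (units-suc js) (cong (0ℤ ∷_) eq)) ⟩
        ∑ (List.replicate q (unit zero)) +ᵥ (0ℤ ∷ x)
          ≡⟨ units-replicate q 0ℤ x ⟩
        (+ q ℤ.* + D ℤ.+ 0ℤ) ∷ x
          ≡⟨ cong (_∷ x) (trans (ℤ.+-identityʳ _) (sym a≡)) ⟩
        a ∷ x ∎)
    , (begin
        a ℤ.+ total x                                 ≡⟨ cong₂ ℤ._+_ a≡ len ⟩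
        + q ℤ.* + D ℤ.+ + length js ℤ.* + D           ≡⟨ ℤ.*-distribʳ-+ (+ D) (+ q) (+ length js) ⟨
        + (q ℕ.+ length js) ℤ.* + D                   ≡⟨ cong (λ k → + k ℤ.* + D) (sym lengths) ⟩
        + length (List.replicate q zero ++ List.map suc js) ℤ.* + D ∎)
    where
    open ≡-Reasoning
    lengths : length (List.replicate q zero ++ List.map suc js) ≡ q ℕ.+ length js
    lengths = trans (List.length-++ (List.replicate q zero)) (cong₂ ℕ._+_ (List.length-replicate q) (List.length-map suc js))

  lookup-units : ∀ {n} (i : Fin n) js → (∀ {j} → j ∈ js → j ≢ i) → lookup (units js) i ≡ 0ℤ
  lookup-units i []       _ = Vec.lookup-replicate i 0ℤ
  lookup-units i (j ∷ js) p = trans (Vec.lookup-zipWith ℤ._+_ i (unit j) (units js))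
    (cong₂ ℤ._+_ (lookup-unit-≢ j (p (here refl))) (lookup-units i js (p ∘ there)))
    where
    lookup-unit-≢ : ∀ j → j ≢ i → lookup (unit j) i ≡ 0ℤ
    lookup-unit-≢ j j≢i = trans (Vec.lookup∘update′ (j≢i ∘ sym) origin (+ D)) (Vec.lookup-replicate i 0ℤ)

-- Good sequences

module Blocks (D : ℕ) .{{_ : ℕ.NonZero D}} where

  open Units D

  -- Good bs: no nonempty block of consecutive terms of bs has a sum divisible by D.

  data Good {n : ℕ} : List (Lattice n) → Set where
    []  : Good []
    _∷_ : ∀ {b bs} → (∀ cs ds → bs ≡ cs ++ ds → ¬ Divisible (b +ᵥ ∑ cs)) → Good bs → Good (b ∷ bs)

  -- `y` accumulates the terms already read. Started with `y = b`, the search tests exactly the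
  -- blocks that begin at `b`.
  divisiblePrefix? : ∀ {n} (y : Lattice n) bs →
    (∃₂ λ cs ds → bs ≡ cs ++ ds × Divisible (y +ᵥ ∑ cs)) ⊎
    (∀ cs ds → bs ≡ cs ++ ds → ¬ Divisible (y +ᵥ ∑ cs))
  divisiblePrefix? y bs with divisible? y
  ... | yes y≡0 = inj₁ ([] , bs , refl , subst Divisible (sym (+ᵥ-identityʳ y)) y≡0)
  divisiblePrefix? y []       | no y≢0 = inj₂ λ where
    [] ds eq → y≢0 ∘ subst Divisible (+ᵥ-identityʳ y)
    (c ∷ cs) ds ()
  divisiblePrefix? y (b ∷ bs) | no y≢0 with divisiblePrefix? (y +ᵥ b) bs
  ... | inj₁ (cs , ds , refl , div) = inj₁ (b ∷ cs , ds , refl , subst Divisible (+ᵥ-assoc y b (∑ cs)) div)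
  ... | inj₂ none = inj₂ λ where
    []       ds eq   → y≢0 ∘ subst Divisible (+ᵥ-identityʳ y)
    (c ∷ cs) ds refl → none cs ds refl ∘ subst Divisible (sym (+ᵥ-assoc y b (∑ cs)))

  good-or-block : ∀ {n} (bs : List (Lattice n)) → Good bs ⊎
    (∃ λ as → ∃ λ c → ∃₂ λ cs ds → bs ≡ as ++ (c ∷ cs) ++ ds × Divisible (∑ (c ∷ cs)))
  good-or-block [] = inj₁ []
  good-or-block (b ∷ bs) with good-or-block bs
  ... | inj₂ (as , c , cs , ds , refl , div) = inj₂ (b ∷ as , c , cs , ds , refl , div)
  ... | inj₁ good with divisiblePrefix? b bs
  ... | inj₁ (cs , ds , refl , div) = inj₂ ([] , b , cs , ds , refl , div)
  ... | inj₂ none = inj₁ (none ∷ good)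

module Decomposition {d : ℕ} (D : ℕ) .{{_ : ℕ.NonZero D}} (B : FiniteSet (suc d))
  (nonneg  : ∀ {b} → b ∈ B → Nonneg b)
  (total≡D : ∀ {b} → b ∈ B → total b ≡ + D)
  (unit∈B  : ∀ i → Units.unit D i ∈ B)
  where

  open Units D
  open Blocks D
  open AlternatingSums B

  units∈B : ∀ js → All (_∈ B) (List.map unit js)
  units∈B js = All.map⁺ (All.universal unit∈B js)

  instance
    D-positive : ℤ.Positive (+ D)
    D-positive = ℤ.positive (ℤ.+<+ (ℕ.>-nonZero⁻¹ D))

  module _ (m : ℕ) (short : ∀ {bs} → All (_∈ B) bs → Good bs → length bs ℕ.≤ m) where

    -- Removing a block may create a new one across the gap, so the search restarts on `as ++ ds`;
    -- every round shortens the list, which `fuel` records. A block of k elements has total k D and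
    -- is therefore exchanged for exactly k units.
    reduce : ∀ fuel bs js → All (_∈ B) bs → length bs ℕ.≤ fuel → ∃₂ λ bs′ js′ →
      All (_∈ B) bs′ × length bs′ ℕ.≤ m × length bs′ ℕ.+ length js′ ≡ length bs ℕ.+ length js ×
      ∑ bs′ +ᵥ units js′ ≡ ∑ bs +ᵥ units js
    reduce zero [] js bs∈B _ = [] , js , [] , z≤n , refl , refl
    reduce (suc fuel) bs js bs∈B len≤ with good-or-block bs
    ... | inj₁ good = bs , js , bs∈B , short bs∈B good , refl , refl
    ... | inj₂ (as , c , cs , ds , refl , div)
      with as∈B , rest∈B ← All.++⁻ as bs∈B
      with cs∈B , ds∈B ← All.++⁻ (c ∷ cs) rest∈B
      with js₀ , eq , tot ← divisible⇒units (∑ (c ∷ cs)) (nonneg-∑ (All.map nonneg cs∈B)) div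
      = let bs′ , js′ , ∈B , le , lens , sums = reduce fuel (as ++ ds) (js₀ ++ js) (All.++⁺ as∈B ds∈B) shorter
        in bs′ , js′ , ∈B , le , trans lens lengths , trans sums sums≡
      where
      len-js₀ : length js₀ ≡ suc (length cs)
      len-js₀ = ℤ.+-injective (ℤ.*-cancelʳ-≡ _ _ (+ D)
        (trans (sym tot) (total-∑ (+ D) (All.map total≡D cs∈B))))
      len-bs : length (as ++ (c ∷ cs) ++ ds) ≡ length as ℕ.+ (suc (length cs) ℕ.+ length ds)
      len-bs = trans (List.length-++ as) (cong (length as ℕ.+_) (List.length-++ (c ∷ cs)))
      shorter : length (as ++ ds) ℕ.≤ fuel
      shorter = ℕ.≤-pred (ℕ.≤-trans (subst₂ ℕ._≤_ (trans (ℕ.+-suc _ _) (cong suc (sym (List.length-++ as)))) (sym len-bs)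
        (ℕ.+-monoʳ-≤ (length as) (s≤s (ℕ.m≤n+m (length ds) (length cs))))) len≤)
      lengths : length (as ++ ds) ℕ.+ length (js₀ ++ js) ≡ length (as ++ (c ∷ cs) ++ ds) ℕ.+ length js
      lengths = trans (cong₂ ℕ._+_ (List.length-++ as) (trans (List.length-++ js₀) (cong (ℕ._+ length js) len-js₀)))
        (trans (lemma (length as) (length cs) (length ds) (length js)) (cong (ℕ._+ length js) (sym len-bs)))
        where
        lemma : ∀ a c e j → a ℕ.+ e ℕ.+ (suc c ℕ.+ j) ≡ a ℕ.+ (suc c ℕ.+ e) ℕ.+ j
        lemma = ℕ-Solver.solve-∀
      sums≡ : ∑ (as ++ ds) +ᵥ units (js₀ ++ js) ≡ ∑ (as ++ (c ∷ cs) ++ ds) +ᵥ units js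
      sums≡ = begin
        ∑ (as ++ ds) +ᵥ units (js₀ ++ js)
          ≡⟨ cong₂ _+ᵥ_ (∑-++ as ds) (trans (cong ∑ (List.map-++ unit js₀ js)) (∑-++ (List.map unit js₀) _)) ⟩
        ∑ as +ᵥ ∑ ds +ᵥ (units js₀ +ᵥ units js)
          ≡⟨ cong (λ z → ∑ as +ᵥ ∑ ds +ᵥ (z +ᵥ units js)) eq ⟩
        ∑ as +ᵥ ∑ ds +ᵥ (∑ (c ∷ cs) +ᵥ units js)
          ≡⟨ lemma (∑ as) (∑ ds) (∑ (c ∷ cs)) (units js) ⟩
        ∑ as +ᵥ (∑ (c ∷ cs) +ᵥ ∑ ds) +ᵥ units js
          ≡⟨ cong (λ z → ∑ as +ᵥ z +ᵥ units js) (∑-++ (c ∷ cs) ds) ⟨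
        ∑ as +ᵥ ∑ ((c ∷ cs) ++ ds) +ᵥ units js
          ≡⟨ cong (_+ᵥ units js) (∑-++ as ((c ∷ cs) ++ ds)) ⟨
        ∑ (as ++ (c ∷ cs) ++ ds) +ᵥ units js ∎
        where
        open ≡-Reasoning
        lemma : ∀ {n} (a e z u : Lattice n) → a +ᵥ e +ᵥ (z +ᵥ u) ≡ a +ᵥ (z +ᵥ e) +ᵥ u
        lemma []       []       []       []       = refl
        lemma (a ∷ as) (e ∷ es) (z ∷ zs) (u ∷ us) = cong₂ _∷_ (ring a e z u) (lemma as es zs us)
          where
          ring : ∀ a e z u → a ℤ.+ e ℤ.+ (z ℤ.+ u) ≡ a ℤ.+ (z ℤ.+ e) ℤ.+ u
          ring = ℤ-Solver.solve-∀

    decompose : ∀ k {x} → x ∈ k · B → ∃₂ λ bs js →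
      All (_∈ B) bs × length bs ℕ.≤ m × length bs ℕ.+ length js ≡ k × x ≡ ∑ bs +ᵥ units js
    decompose k x∈ with bs₀ , bs₀∈B , refl , refl ← ∈·⇒∑ k x∈
      with bs , js , bs∈B , le , lens , sums ← reduce (length bs₀) bs₀ [] bs₀∈B ℕ.≤-refl
      = bs , js , bs∈B , le , trans lens (ℕ.+-identityʳ _) , trans (sym (+ᵥ-identityʳ _)) (sym sums)

    -- An element of `B` with `i`-th coordinate at least `D`, its total, has no room for any other
    -- nonzero coordinate.
    small-coordinate : ∀ {b} i → b ∈ B → b ≢ unit i → lookup b i ℤ.≤ + D ℤ.- 1ℤ
    small-coordinate {b} i b∈B b≢ with lookup b i ℤ.≤? + D ℤ.- 1ℤ
    ... | yes le = le
    ... | no  ≰  = ⊥-elim (b≢ (trans (concentrated b i (nonneg b∈B) (ℤ.≤-trans (ℤ.≤-reflexive (total≡D b∈B)) D≤))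
                     (cong (origin [ i ]≔_) (total≡D b∈B))))
      where
      D≤ : + D ℤ.≤ lookup b i
      D≤ = subst (ℤ._≤ lookup b i) (lemma (+ D)) (ℤ.i<j⇒suc[i]≤j (ℤ.≰⇒> ≰))
        where
        lemma : ∀ a → 1ℤ ℤ.+ (a ℤ.- 1ℤ) ≡ a
        lemma = ℤ-Solver.solve-∀

    -- The two cases are whether `unit i` occurs among all the summands of the decomposition of `y`,
    -- those in `bs` included. If it does not, the units in `js` leave the `i`-th coordinate
    -- untouched, and each of the at most `m` summands of `u` contributes at most `D - 1` to it.
    remove-unit : ∀ k i y → y ∈ suc k · B → (y -ᵥ unit i ∈ k · B) ⊎
      (∃₂ λ u js → Nonneg u × total u ℤ.≤ + m ℤ.* + D × lookup u i ℤ.≤ + m ℤ.* (+ D ℤ.- 1ℤ) ×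
        lookup u i ≡ lookup y i × y ≡ u +ᵥ units js)
    remove-unit k i y y∈ with bs , js , bs∈B , len≤m , len , refl ← decompose (suc k) y∈
      with unit i ∈? (bs ++ List.map unit js)
    ... | yes p with xs , ys , eq ← ∈.∈-∃++ p = inj₁ (subst₂ (λ l z → z ∈ l · B) len≡k sum≡ (∑∈· rest∈B))
      where
      all∈B : All (_∈ B) (xs ++ unit i ∷ ys)
      all∈B = subst (All (_∈ B)) eq (All.++⁺ bs∈B (units∈B js))
      rest∈B : All (_∈ B) (xs ++ ys)
      rest∈B with q , _ ∷ r ← All.++⁻ xs all∈B = All.++⁺ q r
      len≡k : length (xs ++ ys) ≡ k
      len≡k = ℕ.suc-injective (begin
        suc (length (xs ++ ys))            ≡⟨ cong suc (List.length-++ xs) ⟩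
        suc (length xs ℕ.+ length ys)      ≡⟨ ℕ.+-suc (length xs) (length ys) ⟨
        length xs ℕ.+ suc (length ys)      ≡⟨ List.length-++ xs ⟨
        length (xs ++ unit i ∷ ys)         ≡⟨ cong length eq ⟨
        length (bs ++ List.map unit js)    ≡⟨ List.length-++ bs ⟩
        length bs ℕ.+ length (List.map unit js) ≡⟨ cong (length bs ℕ.+_) (List.length-map unit js) ⟩
        length bs ℕ.+ length js            ≡⟨ len ⟩
        suc k                              ∎)
        where open ≡-Reasoning
      sum≡ : ∑ (xs ++ ys) ≡ ∑ bs +ᵥ units js -ᵥ unit i
      sum≡ = begin
        ∑ (xs ++ ys)                            ≡⟨ sub-cancel (unit i) _ ⟨
        unit i +ᵥ ∑ (xs ++ ys) -ᵥ unit i        ≡⟨ cong (_-ᵥ unit i) (∑-insert xs (unit i) ys) ⟨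
        ∑ (xs ++ unit i ∷ ys) -ᵥ unit i         ≡⟨ cong (λ l → ∑ l -ᵥ unit i) eq ⟨
        ∑ (bs ++ List.map unit js) -ᵥ unit i    ≡⟨ cong (_-ᵥ unit i) (∑-++ bs _) ⟩
        ∑ bs +ᵥ units js -ᵥ unit i              ∎
        where open ≡-Reasoning
    ... | no ∉ = inj₂ (∑ bs , js , nonneg-∑ (All.map nonneg bs∈B)
        , subst (ℤ._≤ + m ℤ.* + D) (sym (total-∑ (+ D) (All.map total≡D bs∈B)))
            (ℤ.*-monoʳ-≤-nonNeg (+ D) (+≤+ len≤m))
        , ℤ.≤-trans (lookup-∑-≤ i (+ D ℤ.- 1ℤ) bs (All.tabulate λ b∈bs →
              small-coordinate i (All.lookup bs∈B b∈bs) λ { refl → ∉ (∈.∈-++⁺ˡ b∈bs) }))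
            (ℤ.*-monoʳ-≤-nonNeg (+ D ℤ.- 1ℤ) {{D-1≥0}} (+≤+ len≤m))
        , trans (sym (ℤ.+-identityʳ _)) (trans (cong (λ z → lookup (∑ bs) i ℤ.+ z)
              (sym (lookup-units i js λ j∈js → λ { refl → ∉ (∈.∈-++⁺ʳ bs (∈.∈-map⁺ unit j∈js)) })))
            (sym (Vec.lookup-zipWith ℤ._+_ i (∑ bs) (units js))))
        , refl)
      where
      D-1≥0 : ℤ.NonNegative (+ D ℤ.- 1ℤ)
      D-1≥0 = ℤ.nonNegative (ℤ.i≤j⇒0≤j-i (+≤+ (ℕ.>-nonZero⁻¹ D)))

-- Vanishing of differences

module Vanishing {d : ℕ} (D : ℕ) .{{_ : ℕ.NonZero D}} (B : FiniteSet (suc d))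
  (nonneg  : ∀ {b} → b ∈ B → Nonneg b)
  (total≡D : ∀ {b} → b ∈ B → total b ≡ + D)
  (unit∈B  : ∀ i → Units.unit D i ∈ B)
  (m : ℕ) (short : ∀ {bs} → All (_∈ B) bs → Blocks.Good D bs → length bs ℕ.≤ m)
  where

  open Units D
  open Blocks D
  open AlternatingSums B
  open Decomposition D B nonneg total≡D unit∈B

  total-∈· : ∀ k {x} → x ∈ k · B → total x ≡ + k ℤ.* + D
  total-∈· k x∈ with bs , bs∈B , refl , refl ← ∈·⇒∑ k x∈ = total-∑ (+ D) (All.map total≡D bs∈B)

  module _ (h : ℕ) (large : suc d ℕ.* suc m ℕ.≤ h ℕ.+ 1 ℕ.+ 3 ℕ.* d)
           (x : Lattice (suc d)) (total-x : total x ≡ + (suc d ℕ.+ h) ℤ.* + D) where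

    -- Excludes the second alternative of `remove-unit` simultaneously for all `y = u +ᵥ units js`
    -- that are congruent to `x` and share its `i`-th coordinate.
    Toggles : Fin (suc d) → Set
    Toggles i = ∀ u js → Nonneg u → total u ℤ.≤ + m ℤ.* + D → lookup u i ℤ.≤ + m ℤ.* (+ D ℤ.- 1ℤ) →
      lookup u i ≡ lookup x i → Divisible (x -ᵥ (u +ᵥ units js)) → ⊥

    -- Each `x j - u j` is a multiple of `D`, and it is bounded because `x j` is small and `u j`
    -- nonnegative. Adding up these bounds, with equality at `i`, makes the total of `x` too small
    -- for `large`.
    small⇒toggles : (∀ i → lookup x i ℤ.≤ + m ℤ.* (+ D ℤ.- 1ℤ)) → ∀ i → Toggles i
    small⇒toggles small i u js 0≤u total-u _ uᵢ≡xᵢ div = go m large small total-u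
      where
      x-u : ∀ j → + D ∣ lookup x j ℤ.- lookup u j
      x-u j = subst (+ D ∣_) (lemma (lookup x j) (lookup u j) (lookup (units js) j))
        (∣.∣m∣n⇒∣m+n (subst (+ D ∣_) (trans (Vec.lookup-zipWith ℤ._-_ j x _)
                       (cong (λ z → lookup x j ℤ.- z) (Vec.lookup-zipWith ℤ._+_ j u (units js)))) (div j))
                     (divisible-units js j))
        where
        lemma : ∀ x u w → x ℤ.- (u ℤ.+ w) ℤ.+ w ≡ x ℤ.- u
        lemma = ℤ-Solver.solve-∀
      go : ∀ m → suc d ℕ.* suc m ℕ.≤ h ℕ.+ 1 ℕ.+ 3 ℕ.* d → (∀ i → lookup x i ℤ.≤ + m ℤ.* (+ D ℤ.- 1ℤ)) →
        total u ℤ.≤ + m ℤ.* + D → ⊥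
      -- For `m = 0` the bound m (D - 1) is not strictly below m D and the argument below breaks
      -- down. But then no coordinate of `x` is positive, whereas its total is.
      go zero _ small _ = ℤ.<⇒≱ (ℤ.*-monoʳ-<-pos (+ D) {0ℤ} {+ (suc d ℕ.+ h)} (ℤ.+<+ (s≤s z≤n)))
        (subst₂ ℤ._≤_ total-x (total-origin (suc d)) (total-mono x origin λ j →
          subst (lookup x j ℤ.≤_) (sym (Vec.lookup-replicate j 0ℤ)) (small j)))
      go (suc m) large small total-u = ℕ.<⇒≱ contra₂ contra₁
        where
        -- From here on `m` is one less than the bound on the length. Since (m + 1)(D - 1) < (m + 1)
        -- D, a multiple of `D` that is at most (m + 1)(D - 1) is at most `c`.
        c = + m ℤ.* + D
        xⱼ≤ : ∀ j → lookup x j ℤ.≤ lookup u j ℤ.+ c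
        xⱼ≤ j with divides q eq ← x-u j = subst (ℤ._≤ lookup u j ℤ.+ c)
          (trans (cong (λ z → lookup u j ℤ.+ z) (sym eq)) (lemma₀ (lookup x j) (lookup u j)))
          (ℤ.+-monoʳ-≤ (lookup u j) (ℤ.*-monoʳ-≤-nonNeg (+ D) (subst (q ℤ.≤_) (lemma₁ (+ m)) (ℤ.i<j⇒i≤pred[j] q<))))
          where
          lemma₀ : ∀ x u → u ℤ.+ (x ℤ.- u) ≡ x
          lemma₀ = ℤ-Solver.solve-∀
          lemma₁ : ∀ m → ℤ.-1ℤ ℤ.+ (1ℤ ℤ.+ m) ≡ m
          lemma₁ = ℤ-Solver.solve-∀
          lemma₂ : ∀ m D → (1ℤ ℤ.+ m) ℤ.* (D ℤ.- 1ℤ) ≡ (1ℤ ℤ.+ m) ℤ.* D ℤ.+ ℤ.- (1ℤ ℤ.+ m)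
          lemma₂ = ℤ-Solver.solve-∀
          q< : q ℤ.< + suc m
          q< = ℤ.*-cancelʳ-<-nonNeg (+ D) (ℤ.≤-<-trans
            (ℤ.≤-trans (subst (ℤ._≤ lookup x j) eq
               (subst (lookup x j ℤ.- lookup u j ℤ.≤_) (ℤ.+-identityʳ _)
                 (ℤ.+-monoʳ-≤ (lookup x j) (ℤ.neg-mono-≤ (0≤u j)))))
               (ℤ.≤-trans (small j) (ℤ.≤-reflexive (lemma₂ (+ m) (+ D)))))
            (subst (+ suc m ℤ.* + D ℤ.+ ℤ.- + suc m ℤ.<_) (ℤ.+-identityʳ _) (ℤ.+-monoʳ-< (+ suc m ℤ.* + D) ℤ.-<+)))
        contra₁ : suc d ℕ.+ h ℕ.+ m ℕ.≤ suc m ℕ.+ suc d ℕ.* m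
        contra₁ = ℤ.drop‿+≤+ (ℤ.*-cancelʳ-≤-pos _ _ (+ D) (begin
          + (suc d ℕ.+ h ℕ.+ m) ℤ.* + D            ≡⟨ ℤ.*-distribʳ-+ (+ D) (+ (suc d ℕ.+ h)) (+ m) ⟩
          + (suc d ℕ.+ h) ℤ.* + D ℤ.+ c            ≡⟨ cong (ℤ._+ c) total-x ⟨
          total x ℤ.+ c                            ≤⟨ total-lower x u i c xⱼ≤ (ℤ.≤-reflexive (sym uᵢ≡xᵢ)) ⟩
          total u ℤ.+ + suc d ℤ.* c                ≤⟨ ℤ.+-monoˡ-≤ _ total-u ⟩
          + suc m ℤ.* + D ℤ.+ + suc d ℤ.* c        ≡⟨ lemma (+ suc m) (+ D) (+ suc d) (+ m) ⟩
          (+ suc m ℤ.+ + suc d ℤ.* + m) ℤ.* + D    ≡⟨ cong (λ z → (+ suc m ℤ.+ z) ℤ.* + D) (sym (ℤ.pos-* (suc d) m)) ⟩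
          + (suc m ℕ.+ suc d ℕ.* m) ℤ.* + D        ∎))
          where
          open ℤ.≤-Reasoning
          lemma : ∀ a D n m → a ℤ.* D ℤ.+ n ℤ.* (m ℤ.* D) ≡ (a ℤ.+ n ℤ.* m) ℤ.* D
          lemma = ℤ-Solver.solve-∀
        contra₂ : suc m ℕ.+ suc d ℕ.* m ℕ.< suc d ℕ.+ h ℕ.+ m
        contra₂ = ℕ.+-cancelʳ-≤ (2 ℕ.* d) _ _ (subst₂ ℕ._≤_ (lemma₁ d m) (lemma₂ d h m) (ℕ.+-monoˡ-≤ m large))
          where
          lemma₁ : ∀ d m → suc d ℕ.* suc (suc m) ℕ.+ m ≡ suc (suc m ℕ.+ suc d ℕ.* m) ℕ.+ 2 ℕ.* d
          lemma₁ = ℕ-Solver.solve-∀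
          lemma₂ : ∀ d h m → h ℕ.+ 1 ℕ.+ 3 ℕ.* d ℕ.+ m ≡ suc d ℕ.+ h ℕ.+ m ℕ.+ 2 ℕ.* d
          lemma₂ = ℕ-Solver.solve-∀

    -- A coordinate of `x` above m (D - 1) contradicts the bound on `u` at that index. If there is
    -- none, every index will do, and `zero` is taken.
    toggling-index : ∃ Toggles
    toggling-index with Fin.all? (λ i → lookup x i ℤ.≤? + m ℤ.* (+ D ℤ.- 1ℤ))
    ... | yes small = zero , small⇒toggles small zero
    ... | no ¬small with i , ≰ ← Fin.¬∀⟶∃¬ (suc d) _ (λ i → lookup x i ℤ.≤? + m ℤ.* (+ D ℤ.- 1ℤ)) ¬small
      = i , λ u js _ _ le eq _ → ≰ (subst (ℤ._≤ + m ℤ.* (+ D ℤ.- 1ℤ)) eq le)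

    alt-zero : alt (List.map unit (List.allFin (suc d))) h x ≡ 0ℤ
    alt-zero with i , toggles ← toggling-index
      with as , bs , eq ← ∈.∈-∃++ (∈.∈-allFin i)
      = trans (cong (λ js → alt js h x) (trans (cong (List.map unit) eq) (List.map-++ unit as (i ∷ bs))))
          (alt-vanish (unit i) P toggle (List.map unit as) (List.map unit bs) h
            (All.map⁺ (All.tabulate λ j∈ → preserves λ { refl → proj₁ i∉ j∈ }))
            (All.map⁺ (All.tabulate λ j∈ → preserves λ { refl → proj₂ i∉ j∈ }))
            (refl , λ j → subst (+ D ∣_) (sym (trans (Vec.lookup-zipWith ℤ._-_ j x x) (ℤ.+-inverseʳ (lookup x j)))) (divides 0ℤ refl)))
      where
      -- Both the `i`-th coordinate and the class modulo `D` survive the subtraction of `unit j`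
      -- with j ≠ i, that is, of every other vector in the alternating sum.
      P : Lattice (suc d) → Set
      P y = lookup y i ≡ lookup x i × Divisible (x -ᵥ y)
      toggle : ∀ k {y} → P y → χ (suc k) y ≡ χ k (y -ᵥ unit i)
      toggle k {y} (yᵢ≡xᵢ , div) = χ-cong {suc k} {k}
        (λ y∈ → case-remove (remove-unit m short k i y y∈))
        (λ y-∈ → subst (_∈ suc k · B) (add-cancel (unit i) y) (∈.∈-cartesianProductWith⁺ _+ᵥ_ (unit∈B i) y-∈))
        where
        case-remove : _ ⊎ _ → y -ᵥ unit i ∈ k · B
        case-remove (inj₁ y-∈) = y-∈
        case-remove (inj₂ (u , js , 0≤u , total-u , uᵢ≤ , uᵢ≡yᵢ , refl)) =
          ⊥-elim (toggles u js 0≤u total-u uᵢ≤ (trans uᵢ≡yᵢ yᵢ≡xᵢ) div)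
      preserves : ∀ {j} → j ≢ i → ∀ {y} → P y → P (y -ᵥ unit j)
      preserves {j} j≢i {y} (yᵢ≡xᵢ , div) =
        (begin
          lookup (y -ᵥ unit j) i               ≡⟨ Vec.lookup-zipWith ℤ._-_ i y (unit j) ⟩
          lookup y i ℤ.- lookup (unit j) i     ≡⟨ cong₂ ℤ._-_ yᵢ≡xᵢ
                                                    (trans (Vec.lookup∘update′ (j≢i ∘ sym) origin (+ D)) (Vec.lookup-replicate i 0ℤ)) ⟩
          lookup x i ℤ.- 0ℤ                    ≡⟨ ℤ.+-identityʳ _ ⟩
          lookup x i                           ∎)
        , subst Divisible (sym (lemma x y (unit j))) (divisible-+ (x -ᵥ y) (unit j) div (divisible-unit j))
        where
        open ≡-Reasoning
        lemma : ∀ {n} (x y z : Lattice n) → x -ᵥ (y -ᵥ z) ≡ x -ᵥ y +ᵥ z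
        lemma []       []       []       = refl
        lemma (x ∷ xs) (y ∷ ys) (z ∷ zs) = cong₂ _∷_ (ring x y z) (lemma xs ys zs)
          where
          ring : ∀ x y z → x ℤ.- (y ℤ.- z) ≡ x ℤ.- y ℤ.+ z
          ring = ℤ-Solver.solve-∀
      uniq : Unique (as ++ i ∷ bs)
      uniq = subst Unique eq (Unique.allFin⁺ (suc d))
      split : ∀ {n} as {i} {bs : List (Fin n)} → Unique (as ++ i ∷ bs) → (¬ i ∈ as) × (¬ i ∈ bs)
      split []       (i∉ ∷ _) = (λ ()) , λ i∈ → All.lookup i∉ i∈ refl
      split (a ∷ as) (a∉ ∷ u) = (λ { (here refl) → All.lookup a∉ (∈.∈-++⁺ʳ as (here refl)) refl
                                   ; (there i∈) → proj₁ (split as u) i∈ }) , proj₂ (split as u)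
      i∉ = split as uniq

  differences-vanish : ∀ h → suc d ℕ.* suc m ℕ.≤ h ℕ.+ 1 ℕ.+ 3 ℕ.* d → differences (suc d) N h ≡ 0ℤ
  differences-vanish h large = begin
    differences (suc d) N h
      ≡⟨ cong (λ j → differences j N h) len ⟨
    differences (length vs) N h
      ≡⟨ sum-alt vs h X (units∈B (List.allFin (suc d))) (card-unique _)
           (λ {x} x∈ → ∈-dedup⁺ (subst (λ j → x ∈ (j ℕ.+ h) · B) len x∈)) ⟨
    sumOver (alt vs h) X
      ≡⟨ sumOver-zero (alt vs h) X (λ x∈ → alt-zero h large _ (total-∈· (suc d ℕ.+ h) (∈-dedup⁻ _ x∈))) ⟩
    0ℤ ∎
    where
    open ≡-Reasoning
    vs = List.map unit (List.allFin (suc d))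
    X = deduplicate _≟_ ((suc d ℕ.+ h) · B)
    len : length vs ≡ suc d
    len = trans (List.length-map unit (List.allFin (suc d))) (List.length-tabulate id)

-- Growth of sumsets

module Compositions (D : ℕ) .{{_ : ℕ.NonZero D}} where

  open Units D

  -- compositions n t enumerates the vectors with entries in D ℕ and total t D.

  compositions : ∀ n → ℕ → List (Lattice n)
  compositions zero    zero    = [] ∷ []
  compositions zero    (suc t) = []
  compositions (suc n) zero    = origin ∷ []
  compositions (suc n) (suc t) =
    List.map (0ℤ ∷_) (compositions n (suc t)) ++ List.map (unit zero +ᵥ_) (compositions (suc n) t)

  compositions-units : ∀ n t {x} → x ∈ compositions n t → ∃ λ js → length js ≡ t × x ≡ units js
  compositions-units zero    zero    (here refl) = [] , refl , refl
  compositions-units (suc n) zero    (here refl) = [] , refl , refl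
  compositions-units (suc n) (suc t) x∈ with ∈.∈-++⁻ (List.map (0ℤ ∷_) (compositions n (suc t))) x∈
  ... | inj₁ p with y , y∈ , refl ← ∈.∈-map⁻ (0ℤ ∷_) p
               with js , len , refl ← compositions-units n (suc t) y∈
               = List.map suc js , trans (List.length-map suc js) len , sym (units-suc js)
  ... | inj₂ p with y , y∈ , refl ← ∈.∈-map⁻ (unit zero +ᵥ_) p
               with js , len , refl ← compositions-units (suc n) t y∈
               = zero ∷ js , cong suc len , refl

  nonneg-unit : ∀ {n} (j : Fin n) → Nonneg (unit j)
  nonneg-unit zero    zero    = +≤+ z≤n
  nonneg-unit zero    (suc i) = ℤ.≤-reflexive (sym (Vec.lookup-replicate i 0ℤ))
  nonneg-unit (suc j) zero    = ℤ.≤-refl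
  nonneg-unit (suc j) (suc i) = nonneg-unit j i

  nonneg-units : ∀ {n} (js : List (Fin n)) → Nonneg (units js)
  nonneg-units js = nonneg-∑ (All.map⁺ (All.universal nonneg-unit js))

  +ᵥ-injective : ∀ {n} (v : Lattice n) {x y} → v +ᵥ x ≡ v +ᵥ y → x ≡ y
  +ᵥ-injective v eq = trans (sym (sub-cancel v _)) (trans (cong (_-ᵥ v) eq) (sub-cancel v _))

  compositions-unique : ∀ n t → Unique (compositions n t)
  compositions-unique zero    zero    = [] ∷ []
  compositions-unique zero    (suc t) = []
  compositions-unique (suc n) zero    = [] ∷ []
  compositions-unique (suc n) (suc t) = Unique.++⁺
    (Unique.map⁺ Vec.∷-injectiveʳ (compositions-unique n (suc t)))
    (Unique.map⁺ (+ᵥ-injective (unit zero)) (compositions-unique (suc n) t))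
    (λ (p , q) → disjoint p q)
    where
    disjoint : ∀ {x} → x ∈ List.map (0ℤ ∷_) (compositions n (suc t)) →
      x ∈ List.map (unit zero +ᵥ_) (compositions (suc n) t) → ⊥
    disjoint p q with _ , _ , refl ← ∈.∈-map⁻ (0ℤ ∷_) p
      with a ∷ y , y∈ , eq ← ∈.∈-map⁻ (unit zero +ᵥ_) q
      with js , _ , eq′ ← compositions-units (suc n) t y∈
      = ℤ.<-irrefl (Vec.∷-injectiveˡ eq) (ℤ.+-mono-<-≤ {0ℤ} {+ D} (ℤ.+<+ (ℕ.>-nonZero⁻¹ D))
          (subst (λ z → 0ℤ ℤ.≤ lookup z zero) (sym eq′) (nonneg-units js zero)))

  -- A discrete mean value inequality, bounding the increment of the power `suc e` between `t` and
  -- `t + 1`. The step multiplies the previous case by `t` and adds a nonnegative term to complete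
  -- `t` to `suc t`.
  power-suc : ∀ e t → suc t ℕ.^ suc e ℕ.≤ suc e ℕ.* suc t ℕ.^ e ℕ.+ t ℕ.^ suc e
  power-suc zero    t = ℕ.≤-reflexive (lemma t)
    where
    lemma : ∀ t → suc t ℕ.* 1 ≡ 1 ℕ.* 1 ℕ.+ t ℕ.* 1
    lemma = ℕ-Solver.solve-∀
  power-suc (suc e) t = begin
    P ℕ.+ t ℕ.* P                                                ≤⟨ ℕ.+-monoʳ-≤ P (ℕ.*-monoʳ-≤ t (power-suc e t)) ⟩
    P ℕ.+ t ℕ.* (suc e ℕ.* suc t ℕ.^ e ℕ.+ t ℕ.^ suc e)          ≤⟨ ℕ.m≤m+n _ (suc e ℕ.* suc t ℕ.^ e) ⟩
    P ℕ.+ t ℕ.* (suc e ℕ.* suc t ℕ.^ e ℕ.+ t ℕ.^ suc e) ℕ.+ suc e ℕ.* suc t ℕ.^ e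
                                                                 ≡⟨ lemma t (suc e) (suc t ℕ.^ e) (t ℕ.^ suc e) ⟩
    suc (suc e) ℕ.* P ℕ.+ t ℕ.* t ℕ.^ suc e                      ∎
    where
    open ℕ.≤-Reasoning
    P = suc t ℕ.^ suc e
    lemma : ∀ t f q r → suc t ℕ.* q ℕ.+ t ℕ.* (f ℕ.* q ℕ.+ r) ℕ.+ f ℕ.* q ≡ suc f ℕ.* (suc t ℕ.* q) ℕ.+ t ℕ.* r
    lemma = ℕ-Solver.solve-∀

  -- The length is the binomial coefficient (t + d choose d), of which only the leading term is
  -- retained. The recursion of `compositions` is Pascal's rule, and `power-suc` is the matching
  -- induction step.
  compositions-length : ∀ d t → t ℕ.^ d ℕ.≤ d ! ℕ.* length (compositions (suc d) t)
  compositions-length zero zero    = s≤s z≤n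
  compositions-length zero (suc t) = ℕ.≤-trans (compositions-length zero t) (ℕ.≤-reflexive
    (cong (1 ℕ.*_) (sym (List.length-map (unit zero +ᵥ_) (compositions 1 t)))))
  compositions-length (suc d) zero    = z≤n
  compositions-length (suc d) (suc t) = begin
    suc t ℕ.^ suc d
      ≤⟨ power-suc d t ⟩
    suc d ℕ.* suc t ℕ.^ d ℕ.+ t ℕ.^ suc d
      ≤⟨ ℕ.+-mono-≤ (ℕ.*-monoʳ-≤ (suc d) (compositions-length d (suc t))) (compositions-length (suc d) t) ⟩
    suc d ℕ.* (d ! ℕ.* length (compositions (suc d) (suc t))) ℕ.+ suc d ! ℕ.* length (compositions (2 ℕ.+ d) t)
      ≡⟨ lemma (suc d) (d !) _ _ ⟩
    suc d ! ℕ.* (length (compositions (suc d) (suc t)) ℕ.+ length (compositions (2 ℕ.+ d) t))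
      ≡⟨ cong (suc d ! ℕ.*_) (trans (List.length-++ (List.map (0ℤ ∷_) (compositions (suc d) (suc t))))
           (cong₂ ℕ._+_ (List.length-map _ (compositions (suc d) (suc t))) (List.length-map _ (compositions (2 ℕ.+ d) t)))) ⟨
    suc d ! ℕ.* length (compositions (2 ℕ.+ d) (suc t)) ∎
    where
    open ℕ.≤-Reasoning
    lemma : ∀ s f a b → s ℕ.* (f ℕ.* a) ℕ.+ s ℕ.* f ℕ.* b ≡ s ℕ.* f ℕ.* (a ℕ.+ b)
    lemma = ℕ-Solver.solve-∀

module Growth {d : ℕ} (D : ℕ) .{{_ : ℕ.NonZero D}} (B : FiniteSet (suc d))
  (unit∈B  : ∀ i → Units.unit D i ∈ B) where

  open Units D
  open Blocks D
  open Compositions D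

  block : List (Lattice (suc d)) → ℕ → List (Lattice (suc d))
  block cs r = List.map (∑ cs +ᵥ_) (compositions (suc d) r)

  block-unique : ∀ cs r → Unique (block cs r)
  block-unique cs r = Unique.map⁺ (+ᵥ-injective (∑ cs)) (compositions-unique (suc d) r)

  block-⊆ : ∀ {cs} r h → All (_∈ B) cs → length cs ℕ.+ r ≡ h → block cs r ⊆ h · B
  block-⊆ {cs} r h cs∈B len x∈ with y , y∈ , refl ← ∈.∈-map⁻ (∑ cs +ᵥ_) x∈
    with js , len-js , refl ← compositions-units (suc d) r y∈
    = subst₂ (λ z l → z ∈ l · B) (∑-++ cs (List.map unit js))
        (trans (List.length-++ cs) (trans (cong (length cs ℕ.+_) (trans (List.length-map unit js) len-js)) len))
        (∑∈· (All.++⁺ cs∈B (All.map⁺ (All.universal unit∈B js))))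

  block-class : ∀ cs r {x} → x ∈ block cs r → Divisible (x -ᵥ ∑ cs)
  block-class cs r x∈ with y , y∈ , refl ← ∈.∈-map⁻ (∑ cs +ᵥ_) x∈
    with js , len-js , refl ← compositions-units (suc d) r y∈
    = subst Divisible (sym (sub-cancel (∑ cs) (units js))) (divisible-units js)

  -- Within a fixed sumset, longer sums `cs` leave fewer units `r`; `r₀` is a lower bound common to
  -- all blocks, so that their estimates can be added.
  block-length : ∀ cs r₀ r → r₀ ℕ.≤ r → r₀ ℕ.^ d ℕ.≤ d ! ℕ.* length (block cs r)
  block-length cs r₀ r r₀≤r = ℕ.≤-trans (ℕ.^-monoˡ-≤ d r₀≤r) (ℕ.≤-trans (compositions-length d r)
    (ℕ.≤-reflexive (cong (d ! ℕ.*_) (sym (List.length-map (∑ cs +ᵥ_) (compositions (suc d) r))))))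

  -- The suffix sums of bs are pairwise incongruent modulo D, and each of them contributes
  -- its own block.

  blocks : ∀ {bs} → All (_∈ B) bs → Good bs → ∀ r₀ r h → r₀ ℕ.≤ r → length bs ℕ.+ r ≡ h →
    ∃ λ L → Unique L × L ⊆ h · B ×
      (∀ {x} → x ∈ L → ∃₂ λ as cs → bs ≡ as ++ cs × Divisible (x -ᵥ ∑ cs)) ×
      suc (length bs) ℕ.* r₀ ℕ.^ d ℕ.≤ d ! ℕ.* length L
  blocks {[]} [] [] r₀ r h r₀≤r len = block [] r , block-unique [] r , block-⊆ r h [] len
    , (λ x∈ → [] , [] , refl , block-class [] r x∈)
    , ℕ.≤-trans (ℕ.≤-reflexive (ℕ.*-identityˡ _)) (block-length [] r₀ r r₀≤r)
  blocks {b ∷ bs} (b∈B ∷ bs∈B) (none ∷ good) r₀ r h r₀≤r len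
    with L , uniq , L⊆ , class , long ←
      blocks bs∈B good r₀ (suc r) h (ℕ.m≤n⇒m≤1+n r₀≤r) (trans (ℕ.+-suc (length bs) r) len)
    = block (b ∷ bs) r ++ L
    , Unique.++⁺ (block-unique (b ∷ bs) r) uniq (λ (p , q) → disjoint p q)
    , (λ x∈ → [ block-⊆ r h (b∈B ∷ bs∈B) len , L⊆ ]′ (∈.∈-++⁻ (block (b ∷ bs) r) x∈))
    , (λ x∈ → [ (λ p → [] , b ∷ bs , refl , block-class (b ∷ bs) r p)
              , (λ q → let as , cs , eq , div = class q in b ∷ as , cs , cong (b ∷_) eq , div)
              ]′ (∈.∈-++⁻ (block (b ∷ bs) r) x∈))
    , ℕ.≤-trans (ℕ.+-mono-≤ (block-length (b ∷ bs) r₀ r r₀≤r) long)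
        (ℕ.≤-reflexive (trans (sym (ℕ.*-distribˡ-+ (d !) (length (block (b ∷ bs) r)) (length L)))
          (cong (d ! ℕ.*_) (sym (List.length-++ (block (b ∷ bs) r))))))
    where
    disjoint : ∀ {x} → x ∈ block (b ∷ bs) r → x ∈ L → ⊥
    -- A common element would make the suffix sums of `b ∷ as ++ cs` and of `cs` congruent, so the
    -- block `b ∷ as` would have a sum divisible by `D`.
    disjoint {x} p q with as , cs , refl , div ← class q = none as cs refl
      (subst Divisible (trans (cong (λ s → x -ᵥ ∑ cs -ᵥ (x -ᵥ (b +ᵥ s))) (∑-++ as cs)) (lemma x b (∑ as) (∑ cs)))
        (divisible-- (x -ᵥ ∑ cs) (x -ᵥ ∑ (b ∷ as ++ cs)) div (block-class (b ∷ bs) r p)))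
      where
      lemma : ∀ {n} (x b s t : Lattice n) → x -ᵥ t -ᵥ (x -ᵥ (b +ᵥ (s +ᵥ t))) ≡ b +ᵥ s
      lemma []       []       []       []       = refl
      lemma (x ∷ xs) (b ∷ bs) (s ∷ ss) (t ∷ ts) = cong₂ _∷_ (ring x b s t) (lemma xs bs ss ts)
        where
        ring : ∀ x b s t → x ℤ.- t ℤ.- (x ℤ.- (b ℤ.+ (s ℤ.+ t))) ≡ b ℤ.+ s
        ring = ℤ-Solver.solve-∀

  growth : ∀ {bs} → All (_∈ B) bs → Good bs → ∀ r →
    suc (length bs) ℕ.* r ℕ.^ d ℕ.≤ d ! ℕ.* ∣ (length bs ℕ.+ r) · B ∣
  growth bs∈B good r with L , uniq , L⊆ , _ , long ← blocks bs∈B good r r _ ℕ.≤-refl refl =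
    ℕ.≤-trans long (ℕ.*-monoʳ-≤ (d !) (length-⊆ uniq (∈-dedup⁺ ∘ L⊆)))

-- Barycentric coordinates

infixl 6 _⊞_
infixr 7 _•_

_⊞_ : ∀ {d} → Point d → Point d → Point d
_⊞_ = zipWith _+_

_•_ : ∀ {d} → ℚ → Point d → Point d
c • x = Vec.map (c *_) x

0ₚ : ∀ {d} → Point d
0ₚ = replicate _ 0ℚ

⊞-interchange : ∀ {d} (x y z w : Point d) → (x ⊞ y) ⊞ (z ⊞ w) ≡ (x ⊞ z) ⊞ (y ⊞ w)
⊞-interchange []       []       []       []       = refl
⊞-interchange (x ∷ xs) (y ∷ ys) (z ∷ zs) (w ∷ ws) = cong₂ _∷_ (ring x y z w) (⊞-interchange xs ys zs ws)
  where
  ring : ∀ x y z w → (x + y) + (z + w) ≡ (x + z) + (y + w)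
  ring = ℚ-Solver.solve-∀ ℚ-ring

•-distribʳ : ∀ {d} a b (x : Point d) → (a + b) • x ≡ a • x ⊞ b • x
•-distribʳ a b []       = refl
•-distribʳ a b (x ∷ xs) = cong₂ _∷_ (ℚ.*-distribʳ-+ x a b) (•-distribʳ a b xs)

•-distribˡ : ∀ {d} a (x y : Point d) → a • (x ⊞ y) ≡ a • x ⊞ a • y
•-distribˡ a []       []       = refl
•-distribˡ a (x ∷ xs) (y ∷ ys) = cong₂ _∷_ (ℚ.*-distribˡ-+ a x y) (•-distribˡ a xs ys)

•-assoc : ∀ {d} a b (x : Point d) → a • (b • x) ≡ (a * b) • x
•-assoc a b []       = refl
•-assoc a b (x ∷ xs) = cong₂ _∷_ (sym (ℚ.*-assoc a b x)) (•-assoc a b xs)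

•-identity : ∀ {d} (x : Point d) → 1ℚ • x ≡ x
•-identity []       = refl
•-identity (x ∷ xs) = cong₂ _∷_ (ℚ.*-identityˡ x) (•-identity xs)

•-zeroˡ : ∀ {d} (x : Point d) → 0ℚ • x ≡ 0ₚ
•-zeroˡ []       = refl
•-zeroˡ (x ∷ xs) = cong₂ _∷_ (ℚ.*-zeroˡ x) (•-zeroˡ xs)

•-zeroʳ : ∀ d a → a • 0ₚ {d} ≡ 0ₚ
•-zeroʳ zero    a = refl
•-zeroʳ (suc d) a = cong₂ _∷_ (ℚ.*-zeroʳ a) (•-zeroʳ d a)

⊞-identityˡ : ∀ {d} (x : Point d) → 0ₚ ⊞ x ≡ x
⊞-identityˡ = Vec.zipWith-identityˡ ℚ.+-identityˡ

⊞-identityʳ : ∀ {d} (x : Point d) → x ⊞ 0ₚ ≡ x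
⊞-identityʳ = Vec.zipWith-identityʳ ℚ.+-identityʳ

•-cancel : ∀ {d} n .{{_ : ℕ.NonZero n}} (x y : Point d) → fromℕ n • x ≡ fromℕ n • y → x ≡ y
•-cancel n x y eq = trans (sym (invert x)) (trans (cong ((1ℤ / n) •_) eq) (invert y))
  where
  invert : ∀ {d} (x : Point d) → (1ℤ / n) • (fromℕ n • x) ≡ x
  invert x = trans (•-assoc (1ℤ / n) (fromℕ n) x) (trans (cong (_• x) (/-*-cancel 1ℤ n)) (•-identity x))

module _ {d : ℕ} where

  combination-⊞ : ∀ {n} (ws us : Vec ℚ n) (ps : Vec (Point d) n) →
    combination (ws ⊞ us) ps ≡ combination ws ps ⊞ combination us ps
  combination-⊞ []       []       []       = sym (⊞-identityˡ 0ₚ)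
  combination-⊞ (w ∷ ws) (u ∷ us) (p ∷ ps) = trans
    (cong₂ _⊞_ (•-distribʳ w u p) (combination-⊞ ws us ps)) (⊞-interchange (w • p) (u • p) _ _)

  combination-• : ∀ {n} c (ws : Vec ℚ n) (ps : Vec (Point d) n) →
    combination (c • ws) ps ≡ c • combination ws ps
  combination-• c []       []       = sym (•-zeroʳ d c)
  combination-• c (w ∷ ws) (p ∷ ps) = trans
    (cong₂ _⊞_ (sym (•-assoc c w p)) (combination-• c ws ps)) (sym (•-distribˡ c (w • p) _))

  combination-0ₚ : ∀ {n} (ps : Vec (Point d) n) → combination 0ₚ ps ≡ 0ₚ
  combination-0ₚ []       = refl
  combination-0ₚ (p ∷ ps) = trans (cong₂ _⊞_ (•-zeroˡ p) (combination-0ₚ ps)) (⊞-identityˡ 0ₚ)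

  combination-basis : ∀ {n} (ps : Vec (Point d) n) j → combination (0ₚ [ j ]≔ 1ℚ) ps ≡ lookup ps j
  combination-basis (p ∷ ps) zero    = trans (cong₂ _⊞_ (•-identity p) (combination-0ₚ ps)) (⊞-identityʳ p)
  combination-basis (p ∷ ps) (suc j) = trans (cong₂ _⊞_ (•-zeroˡ p) (combination-basis ps j)) (⊞-identityˡ _)

sum-⊞ : ∀ {n} (ws us : Vec ℚ n) → sum (ws ⊞ us) ≡ sum ws + sum us
sum-⊞ []       []       = refl
sum-⊞ (w ∷ ws) (u ∷ us) = trans (cong (λ s → w + u + s) (sum-⊞ ws us)) (ring w u (sum ws) (sum us))
  where
  ring : ∀ w u s t → w + u + (s + t) ≡ w + s + (u + t)
  ring = ℚ-Solver.solve-∀ ℚ-ring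

sum-• : ∀ {n} c (ws : Vec ℚ n) → sum (c • ws) ≡ c * sum ws
sum-• c []       = sym (ℚ.*-zeroʳ c)
sum-• c (w ∷ ws) = trans (cong (λ s → c * w + s) (sum-• c ws)) (sym (ℚ.*-distribˡ-+ c w _))

sum-0ₚ : ∀ n → sum (0ₚ {n}) ≡ 0ℚ
sum-0ₚ zero    = refl
sum-0ₚ (suc n) = trans (ℚ.+-identityˡ _) (sum-0ₚ n)

sum-basis : ∀ {n} (j : Fin n) → sum (0ₚ [ j ]≔ 1ℚ) ≡ 1ℚ
sum-basis {suc n} zero    = trans (cong (λ s → 1ℚ + s) (sum-0ₚ n)) (ℚ.+-identityʳ 1ℚ)
sum-basis         (suc j) = trans (ℚ.+-identityˡ _) (sum-basis j)

sum-fromℤ : ∀ {n} (y : Lattice n) → sum (Vec.map fromℤ y) ≡ fromℤ (total y)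
sum-fromℤ []      = refl
sum-fromℤ (a ∷ y) = trans (cong (λ s → fromℤ a + s) (sum-fromℤ y)) (sym (fromℤ-+ a (total y)))

map-fromℤ-+ᵥ : ∀ {n} (x y : Lattice n) → Vec.map fromℤ (x +ᵥ y) ≡ Vec.map fromℤ x ⊞ Vec.map fromℤ y
map-fromℤ-+ᵥ []       []       = refl
map-fromℤ-+ᵥ (x ∷ xs) (y ∷ ys) = cong₂ _∷_ (fromℤ-+ x y) (map-fromℤ-+ᵥ xs ys)

fromℕ-* : ∀ m n → fromℕ (m ℕ.* n) ≡ fromℕ m * fromℕ n
fromℕ-* m n = trans (cong fromℤ (ℤ.pos-* m n)) (fromℤ-* (+ m) (+ n))

map-fromℤ-scale : ∀ {n} k (x : Lattice n) → Vec.map fromℤ (Vec.map (+ k ℤ.*_) x) ≡ fromℕ k • Vec.map fromℤ x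
map-fromℤ-scale k []       = refl
map-fromℤ-scale k (x ∷ xs) = cong₂ _∷_ (fromℤ-* (+ k) x) (map-fromℤ-scale k xs)

map-fromℤ-origin : ∀ n → Vec.map fromℤ (origin {n}) ≡ 0ₚ
map-fromℤ-origin n = Vec.map-replicate fromℤ 0ℤ n

map-fromℤ-injective : ∀ {n} {x y : Lattice n} → Vec.map fromℤ x ≡ Vec.map fromℤ y → x ≡ y
map-fromℤ-injective {x = []}     {[]}     _  = refl
map-fromℤ-injective {x = x ∷ xs} {y ∷ ys} eq =
  cong₂ _∷_ (fromℤ-injective (Vec.∷-injectiveˡ eq)) (map-fromℤ-injective (Vec.∷-injectiveʳ eq))

coordinates-unique : ∀ {d n} {ps : Vec (Point d) n} → AffinelyIndependent ps → ∀ {ws us} →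
  sum ws ≡ sum us → combination ws ps ≡ combination us ps → ws ≡ us
coordinates-unique {d} {n} {ps} indep {ws} {us} sums combs = vanish ws us (indep (ws ⊞ - 1ℚ • us)
  (begin
    sum (ws ⊞ - 1ℚ • us)         ≡⟨ sum-⊞ ws _ ⟩
    sum ws + sum (- 1ℚ • us)     ≡⟨ cong₂ _+_ sums (sum-• (- 1ℚ) us) ⟩
    sum us + - 1ℚ * sum us       ≡⟨ ring (sum us) ⟩
    0ℚ                           ∎)
  (begin
    combination (ws ⊞ - 1ℚ • us) ps                  ≡⟨ combination-⊞ ws _ ps ⟩
    combination ws ps ⊞ combination (- 1ℚ • us) ps   ≡⟨ cong₂ _⊞_ combs (combination-• (- 1ℚ) us ps) ⟩
    combination us ps ⊞ - 1ℚ • combination us ps     ≡⟨ opposite (combination us ps) ⟩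
    0ₚ                                               ∎))
  where
  open ≡-Reasoning
  ring : ∀ x → x + - 1ℚ * x ≡ 0ℚ
  ring = ℚ-Solver.solve-∀ ℚ-ring
  opposite : ∀ {d} (x : Point d) → x ⊞ - 1ℚ • x ≡ 0ₚ
  opposite []       = refl
  opposite (x ∷ xs) = cong₂ _∷_ (ring x) (opposite xs)
  vanish : ∀ {n} (ws us : Vec ℚ n) → VecAll.All (_≡ 0ℚ) (ws ⊞ - 1ℚ • us) → ws ≡ us
  vanish []       []       _            = refl
  vanish (w ∷ ws) (u ∷ us) (eq ∷ eqs) = cong₂ _∷_
    (trans (ring′ w u) (trans (cong (_+ u) eq) (ℚ.+-identityˡ u))) (vanish ws us eqs)
    where
    ring′ : ∀ w u → w ≡ w + - 1ℚ * u + u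
    ring′ = ℚ-Solver.solve-∀ ℚ-ring

-- conv ps is definitionally Cone ps 1ℚ.

Cone : ∀ {d n} → Vec (Point d) n → ℚ → Point d → Set
Cone {n = n} ps k x = Σ (Vec ℚ n) λ ws → VecAll.All (0ℚ ≤_) ws × sum ws ≡ k × x ≡ combination ws ps

0≤* : ∀ {p q} → 0ℚ ≤ p → 0ℚ ≤ q → 0ℚ ≤ p * q
0≤* {p} {q} 0≤p 0≤q = subst (_≤ p * q) (ℚ.*-zeroʳ p) (ℚ.*-monoˡ-≤-nonNeg p {{ℚ.nonNegative 0≤p}} 0≤q)

0≤1 : 0ℚ ≤ 1ℚ
0≤1 = fromℤ-mono-≤ {0ℤ} {1ℤ} (+≤+ z≤n)

cone-zero : ∀ {d n} (ps : Vec (Point d) n) → Cone ps 0ℚ 0ₚ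
cone-zero {n = n} ps = 0ₚ , VecAll.lookup⁻ (λ i → ℚ.≤-reflexive (sym (Vec.lookup-replicate i 0ℚ)))
  , sum-0ₚ n , sym (combination-0ₚ ps)

cone-+ : ∀ {d n} {ps : Vec (Point d) n} {k l x y} → Cone ps k x → Cone ps l y → Cone ps (k + l) (x ⊞ y)
cone-+ {ps = ps} (ws , 0≤ws , refl , refl) (us , 0≤us , refl , refl) =
  ws ⊞ us , VecAll.zipWith ℚ.+-mono-≤ 0≤ws 0≤us , sum-⊞ ws us , sym (combination-⊞ ws us ps)

cone-• : ∀ {d n} {ps : Vec (Point d) n} {k x c} → 0ℚ ≤ c → Cone ps k x → Cone ps (c * k) (c • x)
cone-• {ps = ps} {c = c} 0≤c (ws , 0≤ws , refl , refl) =
  c • ws , VecAll.map⁺ (VecAll.map (0≤* 0≤c) 0≤ws) , sum-• c ws , sym (combination-• c ws ps)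

cone-lookup : ∀ {d n} (ps : Vec (Point d) n) j → Cone ps 1ℚ (lookup ps j)
cone-lookup ps j = 0ₚ [ j ]≔ 1ℚ , 0≤basis j , sum-basis j , sym (combination-basis ps j)
  where
  0≤basis : ∀ {n} (j : Fin n) → VecAll.All (0ℚ ≤_) (0ₚ [ j ]≔ 1ℚ)
  0≤basis zero    = 0≤1 ∷ VecAll.lookup⁻ (λ i → ℚ.≤-reflexive (sym (Vec.lookup-replicate i 0ℚ)))
  0≤basis (suc j) = ℚ.≤-refl ∷ 0≤basis j

points : ∀ {d} (A : FiniteSet d) → Vec (Point d) (length (List.map (Vec.map fromℤ) A))
points A = Vec.fromList (List.map (Vec.map fromℤ) A)

cone-∈ : ∀ {d} {A : FiniteSet d} {a} → a ∈ A → Cone (points A) 1ℚ (Vec.map fromℤ a)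
cone-∈ {A = a ∷ A} (here refl) = cone-lookup (points (a ∷ A)) zero
cone-∈ {A = b ∷ A} (there a∈) with ws , 0≤ws , sum≡1 , eq ← cone-∈ a∈
  = 0ℚ ∷ ws , ℚ.≤-refl ∷ 0≤ws , trans (ℚ.+-identityˡ _) sum≡1
  , trans eq (sym (trans (cong (_⊞ _) (•-zeroˡ (Vec.map fromℤ b))) (⊞-identityˡ _)))

cone-· : ∀ {d} {A : FiniteSet d} k {x} → x ∈ k · A → Cone (points A) (fromℕ k) (Vec.map fromℤ x)
cone-· {d} {A} zero (here refl) = subst (Cone (points A) 0ℚ) (sym (map-fromℤ-origin d)) (cone-zero (points A))
cone-· {A = A} (suc k) x∈ with a , y , a∈A , y∈kA , refl ← ∈.∈-cartesianProductWith⁻ _+ᵥ_ A (k · A) x∈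
  = subst₂ (Cone (points A)) (sym (fromℕ-suc k)) (sym (map-fromℤ-+ᵥ a y)) (cone-+ (cone-∈ a∈A) (cone-· k y∈kA))

∈Δ-scaled : ∀ {d} {A : FiniteSet d} k .{{_ : ℕ.NonZero k}} {x} → x ∈ k · A → Δ A ((1ℤ / k) • Vec.map fromℤ x)
∈Δ-scaled {A = A} k {x} x∈ = subst (λ c → Cone (points A) c ((1ℤ / k) • Vec.map fromℤ x)) (/-*-cancel 1ℤ k)
  (cone-• 0≤1/k (cone-· k x∈))
  where
  0≤1/k : 0ℚ ≤ 1ℤ / k
  0≤1/k = ℚ.nonNegative⁻¹ (1ℤ / k) {{ℚ.normalize-nonNeg 1 k}}

clear-denominators : ∀ {n} (ws : Vec ℚ n) →
  ∃₂ λ D z → ℕ.NonZero D × Vec.map fromℤ z ≡ fromℕ D • ws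
clear-denominators [] = 1 , [] , _ , refl
clear-denominators (w ∷ ws) with D , z , D≢0 , eq ← clear-denominators ws
  = ↧ₙ w ℕ.* D , + D ℤ.* ↥ w ∷ Vec.map (+ ↧ₙ w ℤ.*_) z , ℕ.m*n≢0 (↧ₙ w) D {{_}} {{D≢0}}
  , cong₂ _∷_
      (begin
        fromℤ (+ D ℤ.* ↥ w)              ≡⟨ fromℤ-* (+ D) (↥ w) ⟩
        fromℕ D * fromℤ (↥ w)            ≡⟨ cong (fromℕ D *_) (/-*-cancel (↥ w) (↧ₙ w)) ⟨
        fromℕ D * (↥ w / ↧ₙ w * fromℕ (↧ₙ w)) ≡⟨ cong (λ v → fromℕ D * (v * fromℕ (↧ₙ w))) (ℚ.↥p/↧p≡p w) ⟩
        fromℕ D * (w * fromℕ (↧ₙ w))     ≡⟨ ring (fromℕ D) w (fromℕ (↧ₙ w)) ⟩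
        fromℕ (↧ₙ w) * fromℕ D * w       ≡⟨ cong (_* w) (fromℕ-* (↧ₙ w) D) ⟨
        fromℕ (↧ₙ w ℕ.* D) * w           ∎)
      (begin
        Vec.map fromℤ (Vec.map (+ ↧ₙ w ℤ.*_) z)  ≡⟨ map-fromℤ-scale (↧ₙ w) z ⟩
        fromℕ (↧ₙ w) • Vec.map fromℤ z           ≡⟨ cong (fromℕ (↧ₙ w) •_) eq ⟩
        fromℕ (↧ₙ w) • (fromℕ D • ws)            ≡⟨ •-assoc (fromℕ (↧ₙ w)) (fromℕ D) ws ⟩
        (fromℕ (↧ₙ w) * fromℕ D) • ws            ≡⟨ cong (_• ws) (fromℕ-* (↧ₙ w) D) ⟨
        fromℕ (↧ₙ w ℕ.* D) • ws                  ∎)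
  where
  open ≡-Reasoning
  ring : ∀ a b c → a * (b * c) ≡ c * a * b
  ring = ℚ-Solver.solve-∀ ℚ-ring

module Lift {d : ℕ} (A : FiniteSet d) (vs : Vec (Point d) (suc d)) (indep : AffinelyIndependent vs)
            (simplex : ∀ x → Δ A x ⇔ conv vs x) where

  -- b holds the barycentric coordinates of a, multiplied by D.

  record Barycentric (D : ℕ) (a : Lattice d) (b : Lattice (suc d)) : Set where
    constructor barycentric
    field
      b-nonneg : Nonneg b
      total-b  : total b ≡ + D
      point-a  : fromℕ D • Vec.map fromℤ a ≡ combination (Vec.map fromℤ b) vs

  barycentric-scale : ∀ k {D a b} → Barycentric D a b → Barycentric (k ℕ.* D) a (Vec.map (+ k ℤ.*_) b)
  barycentric-scale k {D} {a} {b} (barycentric 0≤b tot eq) = barycentric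
    (λ i → subst (0ℤ ℤ.≤_) (sym (Vec.lookup-map i (+ k ℤ.*_) b))
             (subst (ℤ._≤ + k ℤ.* lookup b i) (ℤ.*-zeroʳ (+ k)) (ℤ.*-monoˡ-≤-nonNeg (+ k) (0≤b i))))
    (trans (total-scale b) (trans (cong (+ k ℤ.*_) tot) (sym (ℤ.pos-* k D))))
    (begin
        fromℕ (k ℕ.* D) • Vec.map fromℤ a            ≡⟨ cong (_• Vec.map fromℤ a) (fromℕ-* k D) ⟩
        (fromℕ k * fromℕ D) • Vec.map fromℤ a        ≡⟨ •-assoc (fromℕ k) (fromℕ D) _ ⟨
        fromℕ k • (fromℕ D • Vec.map fromℤ a)        ≡⟨ cong (fromℕ k •_) eq ⟩
        fromℕ k • combination (Vec.map fromℤ b) vs   ≡⟨ combination-• (fromℕ k) (Vec.map fromℤ b) vs ⟨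
        combination (fromℕ k • Vec.map fromℤ b) vs   ≡⟨ cong (λ w → combination w vs) (map-fromℤ-scale k b) ⟨
        combination (Vec.map fromℤ (Vec.map (+ k ℤ.*_) b)) vs ∎)
    where
    open ≡-Reasoning
    total-scale : ∀ {n} (y : Lattice n) → total (Vec.map (+ k ℤ.*_) y) ≡ + k ℤ.* total y
    total-scale []      = sym (ℤ.*-zeroʳ (+ k))
    total-scale (c ∷ y) = trans (cong (λ s → + k ℤ.* c ℤ.+ s) (total-scale y)) (sym (ℤ.*-distribˡ-+ (+ k) c _))

  barycentric-clear : ∀ {a} {ws : Vec ℚ (suc d)} → VecAll.All (0ℚ ≤_) ws → sum ws ≡ 1ℚ →
    Vec.map fromℤ a ≡ combination ws vs → ∀ {D z} → Vec.map fromℤ z ≡ fromℕ D • ws → Barycentric D a z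
  barycentric-clear {a} {ws} 0≤ws sum≡1 eq {D} {z} eq′ = barycentric 0≤z total-z point
    where
    open ≡-Reasoning
    lookup-z : ∀ i → fromℤ (lookup z i) ≡ fromℕ D * lookup ws i
    lookup-z i = begin
      fromℤ (lookup z i)            ≡⟨ Vec.lookup-map i fromℤ z ⟨
      lookup (Vec.map fromℤ z) i    ≡⟨ cong (λ w → lookup w i) eq′ ⟩
      lookup (fromℕ D • ws) i       ≡⟨ Vec.lookup-map i (fromℕ D *_) ws ⟩
      fromℕ D * lookup ws i         ∎
    0≤z : Nonneg z
    0≤z i = fromℤ-cancel-≤ (subst (0ℚ ≤_) (sym (lookup-z i))
      (0≤* (fromℤ-mono-≤ {0ℤ} {+ D} (+≤+ z≤n)) (VecAll.lookup⁺ 0≤ws i)))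
    total-z : total z ≡ + D
    total-z = fromℤ-injective (begin
      fromℤ (total z)         ≡⟨ sum-fromℤ z ⟨
      sum (Vec.map fromℤ z)   ≡⟨ cong sum eq′ ⟩
      sum (fromℕ D • ws)      ≡⟨ sum-• (fromℕ D) ws ⟩
      fromℕ D * sum ws        ≡⟨ cong (fromℕ D *_) sum≡1 ⟩
      fromℕ D * 1ℚ            ≡⟨ ℚ.*-identityʳ (fromℕ D) ⟩
      fromℕ D                 ∎)
    point : fromℕ D • Vec.map fromℤ a ≡ combination (Vec.map fromℤ z) vs
    point = begin
      fromℕ D • Vec.map fromℤ a           ≡⟨ cong (fromℕ D •_) eq ⟩
      fromℕ D • combination ws vs         ≡⟨ combination-• (fromℕ D) ws vs ⟨
      combination (fromℕ D • ws) vs       ≡⟨ cong (λ w → combination w vs) eq′ ⟨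
      combination (Vec.map fromℤ z) vs    ∎

  barycentric-exists : ∀ {a} → a ∈ A → ∃₂ λ D b → ℕ.NonZero D × Barycentric D a b
  barycentric-exists {a} a∈A =
    let ws , 0≤ws , sum≡1 , eq = Equivalence.to (simplex (Vec.map fromℤ a)) (cone-∈ a∈A)
        D , z , D≢0 , eq′ = clear-denominators ws
    in D , z , D≢0 , barycentric-clear 0≤ws sum≡1 eq eq′

  common-denominator : ∀ A′ → A′ ⊆ A →
    ∃ λ D → ℕ.NonZero D × All (λ a → ∃ (Barycentric D a)) A′
  common-denominator []       _     = 1 , _ , []
  common-denominator (a ∷ A′) A′⊆A =
    let D , b , D≢0 , bary = barycentric-exists (A′⊆A (here refl))
        E , E≢0 , barys    = common-denominator A′ (A′⊆A ∘ there)
    in E ℕ.* D , ℕ.m*n≢0 E D {{E≢0}} {{D≢0}}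
     , (Vec.map (+ E ℤ.*_) b , barycentric-scale E bary) ∷ All.map (rescale D E) barys
    where
    rescale : ∀ D E {a} → ∃ (Barycentric E a) → ∃ (Barycentric (E ℕ.* D) a)
    rescale D E {a} (b , bary) = Db , subst (λ F → Barycentric F a Db) (ℕ.*-comm D E) (barycentric-scale D bary)
      where Db = Vec.map (+ D ℤ.*_) b

  module _ (D : ℕ) .{{_ : ℕ.NonZero D}} where

    collect : ∀ {A′} → All (λ a → ∃ (Barycentric D a)) A′ → FiniteSet (suc d)
    collect = All.reduce proj₁

    collect⁺ : ∀ {A′} (barys : All (λ a → ∃ (Barycentric D a)) A′) {a} → a ∈ A′ →
      ∃ λ b → b ∈ collect barys × Barycentric D a b
    collect⁺ ((b , bary) ∷ barys) (here refl) = b , here refl , bary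
    collect⁺ (_ ∷ barys)          (there a∈)  = let b , b∈ , bary = collect⁺ barys a∈ in b , there b∈ , bary

    collect⁻ : ∀ {A′} (barys : All (λ a → ∃ (Barycentric D a)) A′) {b} → b ∈ collect barys →
      ∃ λ a → a ∈ A′ × Barycentric D a b
    collect⁻ ((b , bary) ∷ barys) (here refl) = _ , here refl , bary
    collect⁻ (_ ∷ barys)          (there b∈)  = let a , a∈ , bary = collect⁻ barys b∈ in a , there a∈ , bary

    -- A relation that is one-to-one in both directions: `y` determines `x` because `D` is nonzero,
    -- and `x` determines `y` by affine independence once the total is prescribed. Cardinalities can
    -- thus be compared without choosing a map.
    record Lifts (k : ℕ) (x : Lattice d) (y : Lattice (suc d)) : Set where
      constructor lifts
      field
        total-y : total y ≡ + k ℤ.* + D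
        point-x : fromℕ D • Vec.map fromℤ x ≡ combination (Vec.map fromℤ y) vs

    lifts-zero : Lifts 0 origin origin
    lifts-zero = lifts (total-origin (suc d))
      (trans (cong (fromℕ D •_) (map-fromℤ-origin d)) (trans (•-zeroʳ d (fromℕ D))
          (sym (trans (cong (λ w → combination w vs) (map-fromℤ-origin (suc d))) (combination-0ₚ vs)))))

    lifts-+ : ∀ {k a b x y} → Barycentric D a b → Lifts k x y → Lifts (suc k) (a +ᵥ x) (b +ᵥ y)
    lifts-+ {k} {a} {b} {x} {y} (barycentric _ tot₁ eq₁) (lifts tot₂ eq₂) = lifts
      (trans (total-+ᵥ b y) (trans (cong₂ ℤ._+_ tot₁ tot₂) (ring (+ D) (+ k))))
      (begin
          fromℕ D • Vec.map fromℤ (a +ᵥ x)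
            ≡⟨ cong (fromℕ D •_) (map-fromℤ-+ᵥ a x) ⟩
          fromℕ D • (Vec.map fromℤ a ⊞ Vec.map fromℤ x)
            ≡⟨ •-distribˡ (fromℕ D) (Vec.map fromℤ a) (Vec.map fromℤ x) ⟩
          fromℕ D • Vec.map fromℤ a ⊞ fromℕ D • Vec.map fromℤ x
            ≡⟨ cong₂ _⊞_ eq₁ eq₂ ⟩
          combination (Vec.map fromℤ b) vs ⊞ combination (Vec.map fromℤ y) vs
            ≡⟨ combination-⊞ (Vec.map fromℤ b) (Vec.map fromℤ y) vs ⟨
          combination (Vec.map fromℤ b ⊞ Vec.map fromℤ y) vs
            ≡⟨ cong (λ w → combination w vs) (map-fromℤ-+ᵥ b y) ⟨
          combination (Vec.map fromℤ (b +ᵥ y)) vs ∎)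
      where
      open ≡-Reasoning
      ring : ∀ D k → D ℤ.+ k ℤ.* D ≡ (1ℤ ℤ.+ k) ℤ.* D
      ring = ℤ-Solver.solve-∀

    lifts-injective : ∀ {k x x′ y} → Lifts k x y → Lifts k x′ y → x ≡ x′
    lifts-injective {x = x} {x′} (lifts _ eq) (lifts _ eq′) =
      map-fromℤ-injective (•-cancel D (Vec.map fromℤ x) (Vec.map fromℤ x′) (trans eq (sym eq′)))

    lifts-functional : ∀ {k x y y′} → Lifts k x y → Lifts k x y′ → y ≡ y′
    lifts-functional {y = y} {y′} (lifts tot eq) (lifts tot′ eq′) = map-fromℤ-injective (coordinates-unique indep
      (trans (sum-fromℤ y) (trans (cong fromℤ (trans tot (sym tot′))) (sym (sum-fromℤ y′))))
      (trans (sym eq) eq′))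

    module _ (barys : All (λ a → ∃ (Barycentric D a)) A) where

      private B = collect barys

      lift : ∀ k {x} → x ∈ k · A → ∃ λ y → y ∈ k · B × Lifts k x y
      lift zero    (here refl) = origin , here refl , lifts-zero
      lift (suc k) x∈ with a , x , a∈ , x∈ , refl ← ∈.∈-cartesianProductWith⁻ _+ᵥ_ A (k · A) x∈
        with b , b∈ , bary ← collect⁺ barys a∈ | y , y∈ , lft ← lift k x∈
        = b +ᵥ y , ∈.∈-cartesianProductWith⁺ _+ᵥ_ b∈ y∈ , lifts-+ bary lft

      unlift : ∀ k {y} → y ∈ k · B → ∃ λ x → x ∈ k · A × Lifts k x y
      unlift zero    (here refl) = origin , here refl , lifts-zero
      unlift (suc k) y∈ with b , y , b∈ , y∈ , refl ← ∈.∈-cartesianProductWith⁻ _+ᵥ_ B (k · B) y∈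
        with a , a∈ , bary ← collect⁻ barys b∈ | x , x∈ , lft ← unlift k y∈
        = a +ᵥ x , ∈.∈-cartesianProductWith⁺ _+ᵥ_ a∈ x∈ , lifts-+ bary lft

      card-lift : ∀ k → ∣ k · A ∣ ≡ ∣ k · B ∣
      card-lift k = ℕ.≤-antisym
        (∣∣-≤ {X = k · A} (Lifts k) lifts-injective (lift k))
        (∣∣-≤ {X = k · B} (λ y x → Lifts k x y) lifts-functional (unlift k))

    -- `c` consists of barycentric coordinates multiplied by `D`. The field `dominates` remembers a
    -- single `b` of positive weight, if there is one: where `c` vanishes, so does this nonnegative
    -- `b`, and this identifies it when the combination is a vertex.
    record LiftedCombination {A′} (barys : All (λ a → ∃ (Barycentric D a)) A′)
                             (ws : Vec ℚ (length (List.map (Vec.map fromℤ) A′))) : Set where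
      constructor lifted
      field
        c          : Point (suc d)
        point-c    : fromℕ D • combination ws (points A′) ≡ combination c vs
        sum-c      : sum c ≡ fromℕ D * sum ws
        c-nonneg   : ∀ i → 0ℚ ≤ lookup c i
        dominates  : sum ws ≡ 0ℚ ⊎
          ∃₂ λ b w → b ∈ collect barys × 0ℚ < w × (∀ i → w * fromℤ (lookup b i) ≤ lookup c i)

    lift-combination : ∀ {A′} (barys : All (λ a → ∃ (Barycentric D a)) A′) ws → VecAll.All (0ℚ ≤_) ws →
      LiftedCombination barys ws
    lift-combination [] [] [] = lifted 0ₚ (trans (•-zeroʳ d (fromℕ D)) (sym (combination-0ₚ vs)))
      (trans (sum-0ₚ (suc d)) (sym (ℚ.*-zeroʳ (fromℕ D))))
      (λ i → ℚ.≤-reflexive (sym (Vec.lookup-replicate i 0ℚ))) (inj₁ refl)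
    lift-combination {a ∷ A′} ((b , barycentric 0≤b tot eq) ∷ barys) (w ∷ ws) (0≤w ∷ 0≤ws) =
      step (lift-combination barys ws 0≤ws)
      where
      open ≡-Reasoning
      a′ = Vec.map fromℤ a
      b′ = Vec.map fromℤ b
      ring : ∀ w D s → w * D + D * s ≡ D * (w + s)
      ring = ℚ-Solver.solve-∀ ℚ-ring
      step : LiftedCombination barys ws →
        LiftedCombination ((b , barycentric 0≤b tot eq) ∷ barys) (w ∷ ws)
      step (lifted c point-c sum-c 0≤c dom) = lifted (w • b′ ⊞ c)
        (begin
          fromℕ D • (w • a′ ⊞ combination ws (points A′))
            ≡⟨ •-distribˡ (fromℕ D) (w • a′) (combination ws (points A′)) ⟩
          fromℕ D • (w • a′) ⊞ fromℕ D • combination ws (points A′)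
            ≡⟨ cong₂ _⊞_ (trans (•-assoc (fromℕ D) w a′)
                 (trans (cong (_• a′) (ℚ.*-comm (fromℕ D) w)) (sym (•-assoc w (fromℕ D) a′)))) point-c ⟩
          w • (fromℕ D • a′) ⊞ combination c vs
            ≡⟨ cong (λ z → w • z ⊞ combination c vs) eq ⟩
          w • combination b′ vs ⊞ combination c vs
            ≡⟨ cong (_⊞ combination c vs) (combination-• w b′ vs) ⟨
          combination (w • b′) vs ⊞ combination c vs
            ≡⟨ combination-⊞ (w • b′) c vs ⟨
          combination (w • b′ ⊞ c) vs ∎)
        (begin
          sum (w • b′ ⊞ c)                    ≡⟨ sum-⊞ (w • b′) c ⟩
          sum (w • b′) + sum c                ≡⟨ cong₂ _+_ (sum-• w b′) sum-c ⟩
          w * sum b′ + fromℕ D * sum ws       ≡⟨ cong (λ z → w * z + fromℕ D * sum ws) (trans (sum-fromℤ b) (cong fromℤ tot)) ⟩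
          w * fromℕ D + fromℕ D * sum ws      ≡⟨ ring w (fromℕ D) (sum ws) ⟩
          fromℕ D * (w + sum ws)              ∎)
        (λ i → subst (0ℚ ≤_) (sym (lookup-c i)) (ℚ.+-mono-≤ (0≤wb i) (0≤c i)))
        (dominates (0ℚ ℚ.<? w) dom)
        where
        lookup-c : ∀ i → lookup (w • b′ ⊞ c) i ≡ w * fromℤ (lookup b i) + lookup c i
        lookup-c i = trans (Vec.lookup-zipWith _+_ i (w • b′) c) (cong (_+ lookup c i)
          (trans (Vec.lookup-map i (w *_) b′) (cong (w *_) (Vec.lookup-map i fromℤ b))))
        0≤wb : ∀ i → 0ℚ ≤ w * fromℤ (lookup b i)
        0≤wb i = 0≤* 0≤w (fromℤ-mono-≤ (0≤b i))
        dominates : Dec (0ℚ < w) → _ ⊎ _ → _ ⊎ _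
        dominates (yes 0<w) _ = inj₂ (b , w , here refl , 0<w , λ i →
          subst₂ _≤_ (ℚ.+-identityʳ _) (sym (lookup-c i)) (ℚ.+-monoʳ-≤ (w * fromℤ (lookup b i)) (0≤c i)))
        dominates (no 0≮w) (inj₁ sum≡0) = inj₁ (cong₂ _+_ (ℚ.≤-antisym (ℚ.≮⇒≥ 0≮w) 0≤w) sum≡0)
        dominates (no _) (inj₂ (b₁ , w₁ , b₁∈ , 0<w₁ , le)) = inj₂ (b₁ , w₁ , there b₁∈ , 0<w₁ , λ i →
          ℚ.≤-trans (le i) (subst₂ _≤_ (ℚ.+-identityˡ _) (sym (lookup-c i)) (ℚ.+-monoˡ-≤ (lookup c i) (0≤wb i))))

    open Units D

    supported : ∀ {n} (x : Lattice n) j → (∀ i → i ≢ j → lookup x i ≡ 0ℤ) → x ≡ origin [ j ]≔ total x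
    supported {suc n} (a ∷ x) zero off = cong₂ _∷_
        (trans (sym (ℤ.+-identityʳ a)) (cong (λ z → a ℤ.+ z) (sym (trans (cong total x≡0) (total-origin n))))) x≡0
      where
      vanishes : ∀ {n} (x : Lattice n) → (∀ i → lookup x i ≡ 0ℤ) → x ≡ origin
      vanishes []      _ = refl
      vanishes (a ∷ x) z = cong₂ _∷_ (z zero) (vanishes x (z ∘ suc))
      x≡0 : x ≡ origin
      x≡0 = vanishes x λ i → off (suc i) λ ()
    supported (a ∷ x) (suc j) off = cong₂ _∷_ (off zero λ ()) (trans (supported x j λ i i≢j → off (suc i) (i≢j ∘ Fin.suc-injective))
      (cong (origin [ j ]≔_) (trans (sym (ℤ.+-identityˡ _)) (cong (ℤ._+ total x) (sym (off zero λ ()))))))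

    -- A vertex of the simplex is a convex combination of points of A; by uniqueness of
    -- barycentric coordinates each of these points with positive weight is the vertex itself.

    unit∈ : (barys : All (λ a → ∃ (Barycentric D a)) A) → ∀ j → unit j ∈ collect barys
    unit∈ barys j =
      let ws , 0≤ws , sum≡1 , eq = Equivalence.from (simplex (lookup vs j)) (cone-lookup vs j)
      in from-lifted ws sum≡1 eq (lift-combination barys ws 0≤ws)
      where
      from-lifted : ∀ ws → sum ws ≡ 1ℚ → lookup vs j ≡ combination ws (points A) →
        LiftedCombination barys ws → unit j ∈ collect barys
      from-lifted ws sum≡1 eq (lifted c point-c sum-c 0≤c dom) = result dom
        where
        open ≡-Reasoning
        c≡ : c ≡ fromℕ D • (0ₚ [ j ]≔ 1ℚ)
        c≡ = coordinates-unique indep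
          (begin
            sum c                                     ≡⟨ sum-c ⟩
            fromℕ D * sum ws                          ≡⟨ cong (fromℕ D *_) (trans sum≡1 (sym (sum-basis j))) ⟩
            fromℕ D * sum (0ₚ [ j ]≔ 1ℚ)              ≡⟨ sum-• (fromℕ D) (0ₚ [ j ]≔ 1ℚ) ⟨
            sum (fromℕ D • (0ₚ [ j ]≔ 1ℚ))            ∎)
          (begin
            combination c vs                          ≡⟨ point-c ⟨
            fromℕ D • combination ws (points A)       ≡⟨ cong (fromℕ D •_) eq ⟨
            fromℕ D • lookup vs j                     ≡⟨ cong (fromℕ D •_) (combination-basis vs j) ⟨
            fromℕ D • combination (0ₚ [ j ]≔ 1ℚ) vs   ≡⟨ combination-• (fromℕ D) (0ₚ [ j ]≔ 1ℚ) vs ⟨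
            combination (fromℕ D • (0ₚ [ j ]≔ 1ℚ)) vs ∎)
        c-off : ∀ i → i ≢ j → lookup c i ≡ 0ℚ
        c-off i i≢j = begin
          lookup c i                                  ≡⟨ cong (λ z → lookup z i) c≡ ⟩
          lookup (fromℕ D • (0ₚ [ j ]≔ 1ℚ)) i         ≡⟨ Vec.lookup-map i (fromℕ D *_) (0ₚ [ j ]≔ 1ℚ) ⟩
          fromℕ D * lookup (0ₚ [ j ]≔ 1ℚ) i           ≡⟨ cong (fromℕ D *_)
                                                           (trans (Vec.lookup∘update′ i≢j 0ₚ 1ℚ) (Vec.lookup-replicate i 0ℚ)) ⟩
          fromℕ D * 0ℚ                                ≡⟨ ℚ.*-zeroʳ (fromℕ D) ⟩
          0ℚ                                          ∎
        0<1 : 0ℚ < 1ℚ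
        0<1 = ℚ.*<* (ℤ.+<+ (s≤s z≤n))
        is-unit : ∀ {b w} → Nonneg b → total b ≡ + D → 0ℚ < w →
          (∀ i → w * fromℤ (lookup b i) ≤ lookup c i) → b ≡ unit j
        is-unit {b} {w} 0≤b tot 0<w le = trans (supported b j off) (cong (origin [ j ]≔_) tot)
          where
          off : ∀ i → i ≢ j → lookup b i ≡ 0ℤ
          off i i≢j = ℤ.≤-antisym (fromℤ-cancel-≤ {lookup b i} {0ℤ} (ℚ.*-cancelˡ-≤-pos w {{ℚ.positive 0<w}}
            (subst (w * fromℤ (lookup b i) ≤_) (trans (c-off i i≢j) (sym (ℚ.*-zeroʳ w))) (le i)))) (0≤b i)
        result : _ ⊎ _ → unit j ∈ collect barys
        result (inj₁ sum≡0) = ⊥-elim (ℚ.<⇒≢ 0<1 (trans (sym sum≡0) sum≡1))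
        result (inj₂ (b , w , b∈ , 0<w , le)) =
          let a , _ , barycentric 0≤b tot _ = collect⁻ barys b∈
          in subst (_∈ collect barys) (is-unit 0≤b tot 0<w le) b∈

-- Grid cubes and volume

length-cartesianProductWith : ∀ {X Y Z : Set} (f : X → Y → Z) xs ys →
  length (List.cartesianProductWith f xs ys) ≡ length xs ℕ.* length ys
length-cartesianProductWith f []       ys = refl
length-cartesianProductWith f (x ∷ xs) ys = trans (List.length-++ (List.map (f x) ys))
  (cong₂ ℕ._+_ (List.length-map (f x) ys) (length-cartesianProductWith f xs ys))

-- box N k lists the integral points of the half-open cube of side N with lowest corner N k.

interval : ℕ → ℤ → List ℤ
interval N k = List.map (λ r → + N ℤ.* k ℤ.+ + r) (List.upTo N)

box : ∀ {d} → ℕ → Lattice d → FiniteSet d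
box N []       = [] ∷ []
box N (k ∷ ks) = List.cartesianProductWith _∷_ (interval N k) (box N ks)

length-box : ∀ {d} N (k : Lattice d) → length (box N k) ≡ N ℕ.^ d
length-box N []       = refl
length-box N (k ∷ ks) = trans (length-cartesianProductWith _∷_ (interval N k) (box N ks))
  (cong₂ ℕ._*_ (trans (List.length-map _ (List.upTo N)) (List.length-upTo N)) (length-box N ks))

InBox : ℕ → ℤ → ℤ → Set
InBox N k x = + N ℤ.* k ℤ.≤ x × x ℤ.< + N ℤ.* (k ℤ.+ 1ℤ)

∈-interval : ∀ N k x → InBox N k x → x ∈ interval N k
∈-interval N k x (lo , hi) = subst (_∈ interval N k) x≡ (∈.∈-map⁺ _ (∈.∈-upTo⁺ r<N))
  where
  r = ℤ.∣ x ℤ.- + N ℤ.* k ∣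
  r≡ : + r ≡ x ℤ.- + N ℤ.* k
  r≡ = ℤ.0≤i⇒+∣i∣≡i (ℤ.i≤j⇒0≤j-i lo)
  x≡ : + N ℤ.* k ℤ.+ + r ≡ x
  x≡ = trans (cong (λ z → + N ℤ.* k ℤ.+ z) r≡) (ring (+ N ℤ.* k) x)
    where
    ring : ∀ a x → a ℤ.+ (x ℤ.- a) ≡ x
    ring = ℤ-Solver.solve-∀
  r<N : r ℕ.< N
  r<N = ℤ.drop‿+<+ (subst₂ ℤ._<_ (sym r≡) (ring (+ N) k) (ℤ.+-monoˡ-< (ℤ.- (+ N ℤ.* k)) hi))
    where
    ring : ∀ N k → N ℤ.* (k ℤ.+ 1ℤ) ℤ.+ ℤ.- (N ℤ.* k) ≡ N
    ring = ℤ-Solver.solve-∀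

∈-box : ∀ {d} N {k x : Lattice d} → Pointwise (InBox N) k x → x ∈ box N k
∈-box N []       = here refl
∈-box N (p ∷ ps) = ∈.∈-cartesianProductWith⁺ _∷_ (∈-interval N _ _ p) (∈-box N ps)

module _ (n N : ℕ) .{{_ : ℕ.NonZero n}} .{{_ : ℕ.NonZero N}} where

  private instance
    Nn≢0 : ℕ.NonZero (N ℕ.* n)
    Nn≢0 = ℕ.m*n≢0 N n
    Nn>0 : ℚ.Positive (fromℕ (N ℕ.* n))
    Nn>0 = ℚ.normalize-pos (N ℕ.* n) 1
    Nn≥0 : ℚ.NonNegative (fromℕ (N ℕ.* n))
    Nn≥0 = ℚ.normalize-nonNeg (N ℕ.* n) 1

  refine : ∀ k → k / n * fromℕ (N ℕ.* n) ≡ fromℤ (+ N ℤ.* k)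
  refine k = begin
    k / n * fromℕ (N ℕ.* n)         ≡⟨ cong (k / n *_) (fromℕ-* N n) ⟩
    k / n * (fromℕ N * fromℕ n)     ≡⟨ ring (k / n) (fromℕ N) (fromℕ n) ⟩
    fromℕ N * (k / n * fromℕ n)     ≡⟨ cong (fromℕ N *_) (/-*-cancel k n) ⟩
    fromℕ N * fromℤ k               ≡⟨ fromℤ-* (+ N) k ⟨
    fromℤ (+ N ℤ.* k)               ∎
    where
    open ≡-Reasoning
    ring : ∀ a b c → a * (b * c) ≡ b * (a * c)
    ring = ℚ-Solver.solve-∀ ℚ-ring

  unscale : ∀ x → (1ℤ / (N ℕ.* n)) * fromℤ x * fromℕ (N ℕ.* n) ≡ fromℤ x
  unscale x = begin
    r * fromℤ x * M     ≡⟨ ring r (fromℤ x) M ⟩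
    r * M * fromℤ x     ≡⟨ cong (_* fromℤ x) (/-*-cancel 1ℤ (N ℕ.* n)) ⟩
    1ℚ * fromℤ x        ≡⟨ ℚ.*-identityˡ (fromℤ x) ⟩
    fromℤ x             ∎
    where
    open ≡-Reasoning
    r = 1ℤ / (N ℕ.* n)
    M = fromℕ (N ℕ.* n)
    ring : ∀ a b c → a * b * c ≡ a * c * b
    ring = ℚ-Solver.solve-∀ ℚ-ring

  cube⇒box : ∀ {d} (k x : Lattice d) → Cube n k ((1ℤ / (N ℕ.* n)) • Vec.map fromℤ x) → Pointwise (InBox N) k x
  cube⇒box []       []       []                = []
  cube⇒box (k ∷ ks) (x ∷ xs) ((lo , hi) ∷ ps) =
    ( fromℤ-cancel-≤ (subst₂ _≤_ (refine k) (unscale x) (ℚ.*-monoʳ-≤-nonNeg (fromℕ (N ℕ.* n)) lo))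
    , fromℤ-cancel-< (subst₂ _<_ (unscale x) (refine (k ℤ.+ 1ℤ)) (ℚ.*-monoˡ-<-pos (fromℕ (N ℕ.* n)) hi)))
    ∷ cube⇒box ks xs ps

  -- Scaled by 1 / (N n), the sumset lies in `Δ A` and on the grid of mesh 1 / (N n), of which a
  -- half-open cube of side 1 / n contains exactly N^d points.
  card-covered : ∀ {d} (A : FiniteSet d) ks → (∀ {x} → Δ A x → Any.Any (λ k → Cube n k x) ks) →
    ∣ (N ℕ.* n) · A ∣ ℕ.≤ length ks ℕ.* N ℕ.^ d
  card-covered {d} A ks cover = ℕ.≤-trans
    (length-⊆ (card-unique ((N ℕ.* n) · A)) λ {x} x∈ →
      boxed ks (cover (∈Δ-scaled {A = A} (N ℕ.* n) (∈-dedup⁻ ((N ℕ.* n) · A) x∈))))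
    (ℕ.≤-reflexive (length-boxes ks))
    where
    boxes : List (Lattice d) → FiniteSet d
    boxes = List.concatMap (box N)
    length-boxes : ∀ ks → length (boxes ks) ≡ length ks ℕ.* N ℕ.^ d
    length-boxes []       = refl
    length-boxes (k ∷ ks) = trans (List.length-++ (box N k)) (cong₂ ℕ._+_ (length-box N k) (length-boxes ks))
    boxed : ∀ ks {x} → Any.Any (λ k → Cube n k ((1ℤ / (N ℕ.* n)) • Vec.map fromℤ x)) ks → x ∈ boxes ks
    boxed (k ∷ ks) {x} (here p)  = ∈.∈-++⁺ˡ (∈-box N (cube⇒box k x p))
    boxed (k ∷ ks) (there ps)    = ∈.∈-++⁺ʳ (box N k) (boxed ks ps)

-- Comparison of the growth of sumsets with the volume

^-distribʳ-* : ∀ d m n → (m ℕ.* n) ℕ.^ d ≡ m ℕ.^ d ℕ.* n ℕ.^ d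
^-distribʳ-* zero    m n = refl
^-distribʳ-* (suc d) m n = trans (cong (m ℕ.* n ℕ.*_) (^-distribʳ-* d m n)) (ring m n (m ℕ.^ d) (n ℕ.^ d))
  where
  ring : ∀ m n p q → m ℕ.* n ℕ.* (p ℕ.* q) ≡ m ℕ.* p ℕ.* (n ℕ.* q)
  ring = ℕ-Solver.solve-∀

-- Bernoulli's inequality (1 - l / M)^d ≥ 1 - d l / M for M = l + r, multiplied by M^(d+1) and
-- rearranged to be free of subtraction.
bernoulli : ∀ d l r → (l ℕ.+ r) ℕ.* (l ℕ.+ r) ℕ.^ d ℕ.≤ (l ℕ.+ r) ℕ.* r ℕ.^ d ℕ.+ d ℕ.* l ℕ.* (l ℕ.+ r) ℕ.^ d
bernoulli zero    l r = ℕ.m≤m+n _ 0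
bernoulli (suc d) l r = begin
  M ℕ.* (M ℕ.* M ℕ.^ d)
    ≤⟨ ℕ.*-monoʳ-≤ M (bernoulli d l r) ⟩
  M ℕ.* (M ℕ.* r ℕ.^ d ℕ.+ d ℕ.* l ℕ.* M ℕ.^ d)
    ≡⟨ ring₁ l r d (r ℕ.^ d) (M ℕ.^ d) ⟩
  M ℕ.* (r ℕ.* r ℕ.^ d) ℕ.+ d ℕ.* l ℕ.* (M ℕ.* M ℕ.^ d) ℕ.+ l ℕ.* (M ℕ.* r ℕ.^ d)
    ≤⟨ ℕ.+-monoʳ-≤ (M ℕ.* (r ℕ.* r ℕ.^ d) ℕ.+ d ℕ.* l ℕ.* (M ℕ.* M ℕ.^ d))
         (ℕ.*-monoʳ-≤ l (ℕ.*-monoʳ-≤ M (ℕ.^-monoˡ-≤ d (ℕ.m≤n+m r l)))) ⟩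
  M ℕ.* (r ℕ.* r ℕ.^ d) ℕ.+ d ℕ.* l ℕ.* (M ℕ.* M ℕ.^ d) ℕ.+ l ℕ.* (M ℕ.* M ℕ.^ d)
    ≡⟨ ring₂ (M ℕ.* (r ℕ.* r ℕ.^ d)) l d (M ℕ.* M ℕ.^ d) ⟩
  M ℕ.* (r ℕ.* r ℕ.^ d) ℕ.+ suc d ℕ.* l ℕ.* (M ℕ.* M ℕ.^ d) ∎
  where
  open ℕ.≤-Reasoning
  M = l ℕ.+ r
  ring₁ : ∀ l r d p q → (l ℕ.+ r) ℕ.* ((l ℕ.+ r) ℕ.* p ℕ.+ d ℕ.* l ℕ.* q) ≡
    (l ℕ.+ r) ℕ.* (r ℕ.* p) ℕ.+ d ℕ.* l ℕ.* ((l ℕ.+ r) ℕ.* q) ℕ.+ l ℕ.* ((l ℕ.+ r) ℕ.* p)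
  ring₁ = ℕ-Solver.solve-∀
  ring₂ : ∀ a l d q → a ℕ.+ d ℕ.* l ℕ.* q ℕ.+ l ℕ.* q ≡ a ℕ.+ suc d ℕ.* l ℕ.* q
  ring₂ = ℕ-Solver.solve-∀

fromℕ-nonNeg : ∀ n → ℚ.NonNegative (fromℕ n)
fromℕ-nonNeg n = ℚ.normalize-nonNeg n 1

0≤fromℕ : ∀ n → 0ℚ ≤ fromℕ n
0≤fromℕ n = ℚ.nonNegative⁻¹ (fromℕ n) {{fromℕ-nonNeg n}}

-- A positive rational is at least the reciprocal of its denominator.
archimedean : ∀ δ → 0ℚ < δ → ∀ K M → ↧ₙ δ ℕ.* K ℕ.≤ M → fromℕ K ≤ δ * fromℕ M
archimedean δ 0<δ K M EK≤M = begin
  fromℕ K                                 ≡⟨ ℚ.*-identityˡ (fromℕ K) ⟨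
  1ℚ * fromℕ K                            ≤⟨ ℚ.*-monoʳ-≤-nonNeg (fromℕ K) {{fromℕ-nonNeg K}} 1≤num ⟩
  fromℤ (↥ δ) * fromℕ K                   ≡⟨ cong (_* fromℕ K) num ⟨
  δ * fromℕ (↧ₙ δ) * fromℕ K              ≡⟨ ℚ.*-assoc δ (fromℕ (↧ₙ δ)) (fromℕ K) ⟩
  δ * (fromℕ (↧ₙ δ) * fromℕ K)            ≡⟨ cong (δ *_) (fromℕ-* (↧ₙ δ) K) ⟨
  δ * fromℕ (↧ₙ δ ℕ.* K)                  ≤⟨ ℚ.*-monoˡ-≤-nonNeg δ {{ℚ.nonNegative (ℚ.<⇒≤ 0<δ)}} (fromℤ-mono-≤ (+≤+ EK≤M)) ⟩
  δ * fromℕ M                             ∎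
  where
  open ℚ.≤-Reasoning
  num : δ * fromℕ (↧ₙ δ) ≡ fromℤ (↥ δ)
  num = trans (cong (_* fromℕ (↧ₙ δ)) (sym (ℚ.↥p/↧p≡p δ))) (/-*-cancel (↥ δ) (↧ₙ δ))
  0<num : 0ℚ < fromℤ (↥ δ)
  0<num = subst₂ _<_ (ℚ.*-zeroˡ (fromℕ (↧ₙ δ))) num
    (ℚ.*-monoˡ-<-pos (fromℕ (↧ₙ δ)) {{ℚ.normalize-pos (↧ₙ δ) 1}} 0<δ)
  1≤num : 1ℚ ≤ fromℤ (↥ δ)
  1≤num = fromℤ-mono-≤ {1ℤ} {↥ δ} (ℤ.i<j⇒suc[i]≤j (fromℤ-cancel-< {0ℤ} {↥ δ} 0<num))

2ℚ : ℚ
2ℚ = 1ℚ + 1ℚ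

-- The choice of `ε` spends half of the gap `L - F * V` on the inaccuracy of the covering. The other
-- half, times `M`, must fit into the error term `C`; everything is doubled to avoid dividing.
squeeze : ∀ {L F V ε τ M C} → 2ℚ * F * ε ≡ L - F * V → 0ℚ ≤ M → 0ℚ ≤ F → τ ≤ V + ε →
  L * M ≤ M * (F * τ) + C → (L - F * V) * M ≤ 2ℚ * C
squeeze {L} {F} {V} {ε} {τ} {M} {C} 2Fε 0≤M 0≤F τ≤ le = subst₂ _≤_
  (ring₁ L F V M)
  (trans (cong (λ z → S + S + - (M * (F * V) + M * (F * V) + z * M)) (sym 2Fε)) (ring₂ F V ε M C))
  (ℚ.+-monoˡ-≤ (- (M * (F * V) + M * (F * V) + (L - F * V) * M)) (ℚ.+-mono-≤ LM≤S LM≤S))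
  where
  S = M * (F * (V + ε)) + C
  LM≤S : L * M ≤ S
  LM≤S = ℚ.≤-trans le (ℚ.+-monoˡ-≤ C (ℚ.*-monoˡ-≤-nonNeg M {{ℚ.nonNegative 0≤M}}
    (ℚ.*-monoˡ-≤-nonNeg F {{ℚ.nonNegative 0≤F}} τ≤)))
  ring₁ : ∀ L F V M → L * M + L * M + - (M * (F * V) + M * (F * V) + (L - F * V) * M) ≡ (L - F * V) * M
  ring₁ = ℚ-Solver.solve-∀ ℚ-ring
  ring₂ : ∀ F V ε M C → M * (F * (V + ε)) + C + (M * (F * (V + ε)) + C) +
    - (M * (F * V) + M * (F * V) + (1ℚ + 1ℚ) * F * ε * M) ≡ (1ℚ + 1ℚ) * C
  ring₂ = ℚ-Solver.solve-∀ ℚ-ring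

-- l + 1 translates of a d-dimensional simplex of normalised volume 1 fit into Δ A, up to lower
-- order terms in the dilation factor.

module _ {d : ℕ} (A : FiniteSet d) (l : ℕ)
         (growth : ∀ r → suc l ℕ.* r ℕ.^ d ℕ.≤ d ! ℕ.* ∣ (l ℕ.+ r) · A ∣) where

  -- Put M = N n and r = M - l. `bernoulli` replaces r^d by M^d at the cost of a lower order term.
  -- The factor N^d then cancels, since it occurs both in M^d = N^d n^d and in the number of points
  -- of each cube.
  covered-growth : ∀ n N .{{_ : ℕ.NonZero n}} .{{_ : ℕ.NonZero N}} → l ℕ.≤ N → ∀ ks →
    (∀ {x} → Δ A x → Any.Any (λ k → Cube n k x) ks) →
    suc l ℕ.* (N ℕ.* n) ℕ.* n ℕ.^ d ℕ.≤ N ℕ.* n ℕ.* (d ! ℕ.* length ks) ℕ.+ suc l ℕ.* (d ℕ.* l) ℕ.* n ℕ.^ d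
  covered-growth n N l≤N ks cover = ℕ.*-cancelˡ-≤ (N ℕ.^ d) {{ℕ.m^n≢0 N d}} (begin
    N ℕ.^ d ℕ.* (suc l ℕ.* M ℕ.* n ℕ.^ d)
      ≡⟨ ring₁ (N ℕ.^ d) (suc l) M (n ℕ.^ d) ⟩
    suc l ℕ.* (M ℕ.* (N ℕ.^ d ℕ.* n ℕ.^ d))
      ≡⟨ cong (λ z → suc l ℕ.* (M ℕ.* z)) M^d ⟨
    suc l ℕ.* (M ℕ.* M ℕ.^ d)
      ≤⟨ ℕ.*-monoʳ-≤ (suc l) (subst (λ m → m ℕ.* m ℕ.^ d ℕ.≤ m ℕ.* r ℕ.^ d ℕ.+ d ℕ.* l ℕ.* m ℕ.^ d) l+r≡M (bernoulli d l r)) ⟩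
    suc l ℕ.* (M ℕ.* r ℕ.^ d ℕ.+ d ℕ.* l ℕ.* M ℕ.^ d)
      ≡⟨ ring₂ (suc l) M (r ℕ.^ d) (d ℕ.* l) (M ℕ.^ d) ⟩
    M ℕ.* (suc l ℕ.* r ℕ.^ d) ℕ.+ suc l ℕ.* (d ℕ.* l) ℕ.* M ℕ.^ d
      ≤⟨ ℕ.+-monoˡ-≤ _ (ℕ.*-monoʳ-≤ M (ℕ.≤-trans (subst (λ m → suc l ℕ.* r ℕ.^ d ℕ.≤ d ! ℕ.* ∣ m · A ∣) l+r≡M (growth r))
           (ℕ.*-monoʳ-≤ (d !) (card-covered n N A ks cover)))) ⟩
    M ℕ.* (d ! ℕ.* (length ks ℕ.* N ℕ.^ d)) ℕ.+ suc l ℕ.* (d ℕ.* l) ℕ.* M ℕ.^ d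
      ≡⟨ cong (λ z → M ℕ.* (d ! ℕ.* (length ks ℕ.* N ℕ.^ d)) ℕ.+ suc l ℕ.* (d ℕ.* l) ℕ.* z) M^d ⟩
    M ℕ.* (d ! ℕ.* (length ks ℕ.* N ℕ.^ d)) ℕ.+ suc l ℕ.* (d ℕ.* l) ℕ.* (N ℕ.^ d ℕ.* n ℕ.^ d)
      ≡⟨ ring₃ M (d !) (length ks) (N ℕ.^ d) (suc l ℕ.* (d ℕ.* l)) (n ℕ.^ d) ⟩
    N ℕ.^ d ℕ.* (M ℕ.* (d ! ℕ.* length ks) ℕ.+ suc l ℕ.* (d ℕ.* l) ℕ.* n ℕ.^ d) ∎)
    where
    open ℕ.≤-Reasoning
    M = N ℕ.* n
    r = M ℕ.∸ l
    l+r≡M : l ℕ.+ r ≡ M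
    l+r≡M = ℕ.m+[n∸m]≡n (ℕ.≤-trans l≤N (ℕ.m≤m*n N n))
    M^d : M ℕ.^ d ≡ N ℕ.^ d ℕ.* n ℕ.^ d
    M^d = ^-distribʳ-* d N n
    ring₁ : ∀ a s m b → a ℕ.* (s ℕ.* m ℕ.* b) ≡ s ℕ.* (m ℕ.* (a ℕ.* b))
    ring₁ = ℕ-Solver.solve-∀
    ring₂ : ∀ s m p e q → s ℕ.* (m ℕ.* p ℕ.+ e ℕ.* q) ≡ m ℕ.* (s ℕ.* p) ℕ.+ s ℕ.* e ℕ.* q
    ring₂ = ℕ-Solver.solve-∀
    ring₃ : ∀ m f k a e b → m ℕ.* (f ℕ.* (k ℕ.* a)) ℕ.+ e ℕ.* (a ℕ.* b) ≡ a ℕ.* (m ℕ.* (f ℕ.* k) ℕ.+ e ℕ.* b)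
    ring₃ = ℕ-Solver.solve-∀

  -- Division by n^d turns the number of cubes into their total volume and leaves an error term
  -- independent of `n` and `N`.
  density-growth : ∀ n N .{{_ : ℕ.NonZero n}} .{{_ : ℕ.NonZero N}} → l ℕ.≤ N → ∀ ks →
    (∀ {x} → Δ A x → Any.Any (λ k → Cube n k x) ks) →
    fromℕ (suc l) * fromℕ (N ℕ.* n) ≤
      fromℕ (N ℕ.* n) * (fromℕ (d !) * totalVolume n ks) + fromℕ (suc l ℕ.* (d ℕ.* l))
  density-growth n N l≤N ks cover = ℚ.*-cancelʳ-≤-pos P {{P>0}} (begin
    L * M * P
      ≡⟨ trans (fromℕ-* (suc l ℕ.* (N ℕ.* n)) (n ℕ.^ d)) (cong (_* P) (fromℕ-* (suc l) (N ℕ.* n))) ⟨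
    fromℕ (suc l ℕ.* (N ℕ.* n) ℕ.* n ℕ.^ d)
      ≤⟨ fromℤ-mono-≤ (+≤+ (covered-growth n N l≤N ks cover)) ⟩
    fromℕ (N ℕ.* n ℕ.* (d ! ℕ.* length ks) ℕ.+ C₀ ℕ.* n ℕ.^ d)
      ≡⟨ fromℤ-+ (+ (N ℕ.* n ℕ.* (d ! ℕ.* length ks))) (+ (C₀ ℕ.* n ℕ.^ d)) ⟩
    fromℕ (N ℕ.* n ℕ.* (d ! ℕ.* length ks)) + fromℕ (C₀ ℕ.* n ℕ.^ d)
      ≡⟨ cong₂ _+_ (trans (fromℕ-* (N ℕ.* n) (d ! ℕ.* length ks)) (cong (M *_) (fromℕ-* (d !) (length ks)))) (fromℕ-* C₀ (n ℕ.^ d)) ⟩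
    M * (F * fromℕ (length ks)) + C * P
      ≡⟨ cong (λ z → M * (F * z) + C * P) (/-*-cancel (+ length ks) (n ℕ.^ d) {{n^d≢0}}) ⟨
    M * (F * (τ * P)) + C * P
      ≡⟨ ring M F τ P C ⟩
    (M * (F * τ) + C) * P ∎)
    where
    open ℚ.≤-Reasoning
    C₀ = suc l ℕ.* (d ℕ.* l)
    n^d≢0 : ℕ.NonZero (n ℕ.^ d)
    n^d≢0 = ℕ.m^n≢0 n d
    L = fromℕ (suc l)
    M = fromℕ (N ℕ.* n)
    F = fromℕ (d !)
    C = fromℕ C₀
    P = fromℕ (n ℕ.^ d)
    τ = totalVolume n ks
    P>0 : ℚ.Positive P
    P>0 = ℚ.normalize-pos (n ℕ.^ d) 1 {{_}} {{n^d≢0}}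
    ring : ∀ M F τ P C → M * (F * (τ * P)) + C * P ≡ (M * (F * τ) + C) * P
    ring = ℚ-Solver.solve-∀ ℚ-ring

  volume-bound : ∀ V → HasVolume (Δ A) V → fromℕ (suc l) ≤ fromℕ (d !) * V
  volume-bound V vol = ℚ.≮⇒≥ refute
    where
    L = fromℕ (suc l)
    F = fromℕ (d !)
    C₀ = suc l ℕ.* (d ℕ.* l)
    instance
      2d!≢0 : ℕ.NonZero (2 ℕ.* d !)
      2d!≢0 = ℕ.m*n≢0 2 (d !) {{_}} {{d ℕ.!≢0}}

    excess : ∀ ε → 2ℚ * F * ε ≡ L - F * V → 0ℚ < L - F * V → ∀ n .{{_ : ℕ.NonZero n}} ks →
      (∀ {x} → Δ A x → Any.Any (λ k → Cube n k x) ks) → totalVolume n ks < V + ε → ⊥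
    excess ε 2Fε 0<δ n ks cover small = ℕ.<-irrefl refl (ℤ.drop‿+≤+ (fromℤ-cancel-≤ {+ suc (2 ℕ.* C₀)} {+ (2 ℕ.* C₀)} (begin
      fromℕ (suc (2 ℕ.* C₀))      ≤⟨ archimedean δ 0<δ (suc (2 ℕ.* C₀)) (N ℕ.* n) EK≤M ⟩
      δ * fromℕ (N ℕ.* n)         ≤⟨ squeeze {L} {F} {V} {ε} {totalVolume n ks} {fromℕ (N ℕ.* n)} {fromℕ C₀} 2Fε
                                       (0≤fromℕ (N ℕ.* n)) (0≤fromℕ (d !)) (ℚ.<⇒≤ small) (density-growth n N l≤N ks cover) ⟩
      2ℚ * fromℕ C₀               ≡⟨ fromℕ-* 2 C₀ ⟨
      fromℕ (2 ℕ.* C₀)            ∎)))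
      where
      open ℚ.≤-Reasoning
      δ = L - F * V
      -- The covering, and with it `n`, is already fixed; only the refinement `N` is free. It has to
      -- be at least `l`, and large enough for `δ` times N n to reach 2 C₀ + 1, beyond the bound 2
      -- C₀ given by `squeeze`.
      N = suc (↧ₙ δ ℕ.* suc (2 ℕ.* C₀) ℕ.+ l)
      l≤N : l ℕ.≤ N
      l≤N = ℕ.m≤n⇒m≤1+n (ℕ.m≤n+m l _)
      EK≤M : ↧ₙ δ ℕ.* suc (2 ℕ.* C₀) ℕ.≤ N ℕ.* n
      EK≤M = ℕ.≤-trans (ℕ.m≤n⇒m≤1+n (ℕ.m≤m+n (↧ₙ δ ℕ.* suc (2 ℕ.* C₀)) l)) (ℕ.m≤m*n N n)

    refute : F * V < L → ⊥
    refute FV<L =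
      let n , n≢0 , ks , cover , small = proj₂ (vol ε 0<ε)
      in excess ε 2Fε 0<δ n {{n≢0}} ks cover small
      where
      open ≡-Reasoning
      δ = L - F * V
      r = 1ℤ / (2 ℕ.* d !)
      ε = δ * r
      0<δ : 0ℚ < δ
      0<δ = subst (_< δ) (ℚ.+-inverseʳ (F * V)) (ℚ.+-monoˡ-< (- (F * V)) FV<L)
      0<ε : 0ℚ < ε
      0<ε = subst (_< ε) (ℚ.*-zeroˡ r) (ℚ.*-monoˡ-<-pos r {{ℚ.normalize-pos 1 (2 ℕ.* d !)}} 0<δ)
      2Fε : 2ℚ * F * ε ≡ δ
      2Fε = begin
        2ℚ * F * (δ * r)            ≡⟨ ring (2ℚ * F) δ r ⟩
        δ * (r * (2ℚ * F))          ≡⟨ cong (λ z → δ * (r * z)) (fromℕ-* 2 (d !)) ⟨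
        δ * (r * fromℕ (2 ℕ.* d !)) ≡⟨ cong (δ *_) (/-*-cancel 1ℤ (2 ℕ.* d !)) ⟩
        δ * 1ℚ                      ≡⟨ ℚ.*-identityʳ δ ⟩
        δ                           ∎
        where
        ring : ∀ a b c → a * (b * c) ≡ b * (c * a)
        ring = ℚ-Solver.solve-∀ ℚ-ring

-- From the volume to the polynomial and its threshold

natural-floor : ∀ q → 1ℚ ≤ q → ∃ λ m → fromℕ (suc m) ≤ q × (∀ k → fromℕ k ≤ q → k ℕ.≤ suc m)
natural-floor q 1≤q = positive f refl (upper 1 1≤q)
  where
  E = ↧ₙ q
  f = ↥ q ℤ./ℕ E
  num : q * fromℕ E ≡ fromℤ (↥ q)
  num = trans (cong (_* fromℕ E) (sym (ℚ.↥p/↧p≡p q))) (/-*-cancel (↥ q) E)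
  lower : fromℤ f ≤ q
  lower = ℚ.*-cancelʳ-≤-pos (fromℕ E) {{ℚ.normalize-pos E 1}}
    (subst₂ _≤_ (fromℤ-* f (+ E)) (sym num) (fromℤ-mono-≤ (ℤ.[n/ℕd]*d≤n (↥ q) E)))
  upper : ∀ k → fromℕ k ≤ q → + k ℤ.≤ f
  upper k k≤q = subst (+ k ℤ.≤_) (ℤ.pred-suc f) (ℤ.i<j⇒i≤pred[j] (ℤ.*-cancelʳ-<-nonNeg {+ k} {ℤ.suc f} (+ E) (ℤ.≤-<-trans
    (fromℤ-cancel-≤ (subst₂ _≤_ (sym (fromℤ-* (+ k) (+ E))) num
      (ℚ.*-monoʳ-≤-nonNeg (fromℕ E) {{fromℕ-nonNeg E}} k≤q)))
    (ℤ.n<s[n/ℕd]*d (↥ q) E))))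
  positive : ∀ g → f ≡ g → 1ℤ ℤ.≤ g → ∃ λ m → fromℕ (suc m) ≤ q × (∀ k → fromℕ k ≤ q → k ℕ.≤ suc m)
  positive (+ suc m) f≡g _ = m , subst (λ g → fromℤ g ≤ q) f≡g lower
    , λ k k≤q → ℤ.drop‿+≤+ (subst (+ k ℤ.≤_) f≡g (upper k k≤q))
  positive (+ zero) _ (+≤+ ())

module _ {d : ℕ} (A : FiniteSet d) (vs : Vec (Point d) (suc d)) (indep : AffinelyIndependent vs)
         (simplex : ∀ x → Δ A x ⇔ conv vs x) (V : ℚ) (vol : HasVolume (Δ A) V) where

  open Lift A vs indep simplex

  module _ (D : ℕ) .{{_ : ℕ.NonZero D}} (barys : All (λ a → ∃ (Barycentric D a)) A) where

    private
      B = collect D barys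
      open Blocks D using (Good; [])

      nonneg-B : ∀ {b} → b ∈ B → Nonneg b
      nonneg-B b∈ = let _ , _ , bary = collect⁻ D barys b∈ in Barycentric.b-nonneg bary

      total-B : ∀ {b} → b ∈ B → total b ≡ + D
      total-B b∈ = let _ , _ , bary = collect⁻ D barys b∈ in Barycentric.total-b bary

    good-bound : ∀ {bs} → All (_∈ B) bs → Good bs → fromℕ (suc (length bs)) ≤ fromℕ (d !) * V
    good-bound {bs} bs∈B good = volume-bound A (length bs) (λ r →
      subst (λ c → suc (length bs) ℕ.* r ℕ.^ d ℕ.≤ d ! ℕ.* c) (sym (card-lift D barys (length bs ℕ.+ r)))
        (Growth.growth D B (unit∈ D barys) bs∈B good r)) V vol

    polynomial : Σ ℚ[x] λ p → (h : ℕ) →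
      V * fromℕ (suc d !) - 1ℚ - fromℕ 3 * fromℕ d ≤ fromℕ h → fromℕ ∣ h · A ∣ ≡ eval p (fromℕ h)
    polynomial =
      -- The empty sequence is good, so d! V is at least 1 and its integer part has the form
      -- `suc m`. As a good sequence of length l satisfies l + 1 ≤ d! V, `m` bounds the lengths.
      let m , m≤ , max = natural-floor (fromℕ (d !) * V) (good-bound [] [])
          -- The subtraction is truncated: where the difference would be negative, the polynomial is
          -- valid from h = 0 on.
          p , p≡ = eventually-polynomial (suc d) (suc d ℕ.* suc m ℕ.∸ (1 ℕ.+ 3 ℕ.* d)) (λ h → + ∣ h · B ∣)
            (λ h T≤h → Vanishing.differences-vanish D B nonneg-B total-B (unit∈ D barys) m
              (λ {bs} bs∈B good → ℕ.≤-pred (max (suc (length bs)) (good-bound bs∈B good))) h (from-threshold m h T≤h))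
      in p , λ h large → trans (cong fromℕ (card-lift D barys h)) (p≡ h (to-threshold m m≤ h large))
      where
      from-threshold : ∀ m h → suc d ℕ.* suc m ℕ.∸ (1 ℕ.+ 3 ℕ.* d) ℕ.≤ h → suc d ℕ.* suc m ℕ.≤ h ℕ.+ 1 ℕ.+ 3 ℕ.* d
      from-threshold m h T≤h = ℕ.≤-trans (ℕ.m≤n+m∸n (suc d ℕ.* suc m) (1 ℕ.+ 3 ℕ.* d))
        (ℕ.≤-trans (ℕ.+-monoʳ-≤ (1 ℕ.+ 3 ℕ.* d) T≤h) (ℕ.≤-reflexive (ring h d)))
        where
        ring : ∀ h d → 1 ℕ.+ 3 ℕ.* d ℕ.+ h ≡ h ℕ.+ 1 ℕ.+ 3 ℕ.* d
        ring = ℕ-Solver.solve-∀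
      to-threshold : ∀ m → fromℕ (suc m) ≤ fromℕ (d !) * V → ∀ h →
        V * fromℕ (suc d !) - 1ℚ - fromℕ 3 * fromℕ d ≤ fromℕ h → suc d ℕ.* suc m ℕ.∸ (1 ℕ.+ 3 ℕ.* d) ℕ.≤ h
      to-threshold m m≤ h large = ℕ.m≤n+o⇒m∸n≤o (suc d ℕ.* suc m) (1 ℕ.+ 3 ℕ.* d)
        (ℤ.drop‿+≤+ (fromℤ-cancel-≤ {+ (suc d ℕ.* suc m)} {+ (1 ℕ.+ 3 ℕ.* d ℕ.+ h)} (begin
          fromℕ (suc d ℕ.* suc m)              ≡⟨ fromℕ-* (suc d) (suc m) ⟩
          fromℕ (suc d) * fromℕ (suc m)        ≤⟨ ℚ.*-monoˡ-≤-nonNeg (fromℕ (suc d)) {{fromℕ-nonNeg (suc d)}} m≤ ⟩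
          fromℕ (suc d) * (fromℕ (d !) * V)    ≡⟨ ring₁ (fromℕ (suc d)) (fromℕ (d !)) V ⟩
          V * (fromℕ (suc d) * fromℕ (d !))    ≡⟨ cong (V *_) (fromℕ-* (suc d) (d !)) ⟨
          V * fromℕ (suc d !)                  ≡⟨ ring₂ (V * fromℕ (suc d !)) (fromℕ 3 * fromℕ d) ⟩
          1ℚ + fromℕ 3 * fromℕ d + (V * fromℕ (suc d !) - 1ℚ - fromℕ 3 * fromℕ d)
                                               ≤⟨ ℚ.+-monoʳ-≤ (1ℚ + fromℕ 3 * fromℕ d) large ⟩
          1ℚ + fromℕ 3 * fromℕ d + fromℕ h     ≡⟨ cong (λ z → 1ℚ + z + fromℕ h) (fromℕ-* 3 d) ⟨
          1ℚ + fromℕ (3 ℕ.* d) + fromℕ h       ≡⟨ cong (_+ fromℕ h) (fromℕ-suc (3 ℕ.* d)) ⟨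
          fromℕ (1 ℕ.+ 3 ℕ.* d) + fromℕ h      ≡⟨ fromℤ-+ (+ (1 ℕ.+ 3 ℕ.* d)) (+ h) ⟨
          fromℕ (1 ℕ.+ 3 ℕ.* d ℕ.+ h)          ∎)))
        where
        open ℚ.≤-Reasoning
        ring₁ : ∀ s f V → s * (f * V) ≡ V * (s * f)
        ring₁ = ℚ-Solver.solve-∀ ℚ-ring
        ring₂ : ∀ v t → v ≡ 1ℚ + t + (v - 1ℚ - t)
        ring₂ = ℚ-Solver.solve-∀ ℚ-ring

theorem1p4 : (d : ℕ) (A : FiniteSet d) →
    Generates (A ⊖ A) →
    IsSimplex d (Δ A) →
    (vol : ℚ) → HasVolume (Δ A) vol →
    Σ ℚ[x] λ p → (h : ℕ) →
    vol * fromℕ (suc d !) - 1ℚ - fromℕ 3 * fromℕ d ≤ fromℕ h →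
    fromℕ ∣ h · A ∣ ≡ eval p (fromℕ h)
theorem1p4 d A _ (vs , indep , simplex) V vol =
  let D , D≢0 , barys = Lift.common-denominator A vs indep simplex A id
  in polynomial A vs indep simplex V vol D {{D≢0}} barys
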